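{- Let $G$ be an inner semi-Eulerian plane graph whose outer subgraph is a simple cycle, and let $G'$ be the inner subgraph of $G$ (with the coloring inherited from $G$). Then \[|\mathcal{B}(G)|=2\,|\mathcal{C}_B(G')|.\]
   Context: A plane graph is a finite planar graph with a fixed embedding in the plane. The external face is the unbounded face; all other faces are internal. A vertex is external if it lies on the boundary of the external face, and internal otherwise. A bipartite plane graph (vertices colored black and white) is inner semi-Eulerian if every internal black vertex has even degree. Let $F$ be the set of internal faces. A subset $B\subseteq F$ is a billiard nest if: (1) for each internal black vertex $b$, listing the faces in the angular sectors around $b$ in cyclic order as $f_1,\dots,f_{2k}$, either all of them are in $B$, none are in $B$, or exactly every second one is in $B$ (i.e. exactly $f_1,f_3,\dots$ or exactly $f_2,f_4,\dots$); (2) for each external black vertex $b$, either all internal faces incident to $b$ are in $B$ or none are. $\mathcal{B}(G)$ denotes the set of billiard nests. The inner subgraph $G'$ is the subgraph induced on the internal vertices of $G$; the outer subgraph is the subgraph induced on the external vertices. A channel of a graph $H$ is a vertex set $C$ such that every vertex of $H$ is adjacent to an even number of vertices of $C$ (the empty set included); $\mathcal{C}_B(H)$ is the set of channels of the bipartite graph $H$ consisting only of black vertices.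
   Formalization: The formal statement also assumes that no internal black vertex is isolated (degree 0); without this the claim fails, e.g. for a 4-cycle with an isolated black vertex inside, where |B(G)| = 2 but 2|C_B(G')| = 4. -}

module Defs where

open import Data.Bool.Base using (Bool; true; false; not)
open import Data.Fin.Base using (Fin; toℕ)
open import Data.Fin.Properties using (_≟_; any?; all?)
open import Data.Fin.Subset using (Subset; _∈_; _∉_; inside; outside; ∣_∣)
open import Data.Fin.Subset.Properties using (_∈?_)
open import Data.List.Base using (List; []; _∷_; _++_; map; filter)
open import Data.Nat.Base using (ℕ; zero; suc; _+_; _*_; _%_)
open import Data.Nat.Divisibility using (_∣_; _∣?_)
open import Data.Nat.GeneralisedArithmetic using (fold)
open import Data.Product.Base using (Σ; ∃; _×_; _,_; proj₁; proj₂)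
open import Data.Sum.Base using (_⊎_; inj₁; inj₂)
open import Data.Unit.Base using (⊤)
open import Data.Vec.Base using ([]; _∷_; tabulate)
open import Function.Bundles using (_⇔_; mk⇔; Equivalence)
open import Function.Definitions using (Injective; Surjective)
open import Level using (0ℓ)
open import Relation.Binary.Construct.Closure.ReflexiveTransitive using (Star)
open import Relation.Binary.Core using (Rel)
import Relation.Binary.Definitions as B
open import Relation.Binary.PropositionalEquality.Core
  using (_≡_; _≢_; refl; sym)
open import Relation.Nullary.Decidable
  using (Dec; yes; no; does; map′; ¬?; _×-dec_; _⊎-dec_; _→-dec_)
open import Relation.Nullary.Negation using (¬_)
open import Relation.Unary using (Pred; Decidable)

_⇔-dec_ : ∀ {P Q : Set} → Dec P → Dec Q → Dec (P ⇔ Q)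
P? ⇔-dec Q? =
  map′ (λ { (f , g) → mk⇔ f g })
       (λ e → Equivalence.to e , Equivalence.from e)
       ((P? →-dec Q?) ×-dec (Q? →-dec P?))

-- Every subset of Fin n, listed exactly once.
subsets : ∀ n → List (Subset n)
subsets zero    = [] ∷ []
subsets (suc n) = map (inside ∷_) (subsets n) ++ map (outside ∷_) (subsets n)

-- A finite simple graph whose vertex set is a subset of Fin n; keeping the
-- ambient Fin n lets an induced subgraph inherit names and colours.
record Graph (n : ℕ) : Set₁ where
  field
    Vert       : Pred (Fin n) 0ℓ
    Vert?      : Decidable Vert
    Adj        : Rel (Fin n) 0ℓ
    Adj?       : B.Decidable Adj
    Adj-Vert   : ∀ {u v} → Adj u v → Vert u
    Adj-sym    : ∀ {u v} → Adj u v → Adj v u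
    Adj-irrefl : ∀ {v} → ¬ Adj v v

  degree : Fin n → ℕ
  degree v = ∣ tabulate (λ u → does (Adj? v u)) ∣

  degreeInto : Subset n → Fin n → ℕ
  degreeInto C v = ∣ tabulate (λ u → does (u ∈? C ×-dec Adj? v u)) ∣

induced : ∀ {n} (H : Graph n) {S : Pred (Fin n) 0ℓ} → Decidable S → Graph n
induced H {S} S? = record
  { Vert       = λ v → Vert v × S v
  ; Vert?      = λ v → Vert? v ×-dec S? v
  ; Adj        = λ u v → Adj u v × S u × S v
  ; Adj?       = λ u v → Adj? u v ×-dec S? u ×-dec S? v
  ; Adj-Vert   = λ { (a , su , _) → Adj-Vert a , su }
  ; Adj-sym    = λ { (a , su , sv) → Adj-sym a , sv , su }
  ; Adj-irrefl = λ { (a , _) → Adj-irrefl a }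
  }
  where open Graph H

-- H is a cycle with 3 + k vertices, listed in order by c.
IsSimpleCycle : ∀ {n} → Graph n → Set
IsSimpleCycle {n} H =
  ∃ λ k → Σ (Fin (3 + k) → Fin n) λ c →
    Injective _≡_ _≡_ c
  × (∀ v → Vert v ⇔ ∃ λ i → c i ≡ v)
  × (∀ i j → Adj (c i) (c j) ⇔ (Next i j ⊎ Next j i))
  where
  open Graph H
  Next : ∀ {k} → Rel (Fin (3 + k)) 0ℓ
  Next {k} i j = toℕ j ≡ suc (toℕ i) % (3 + k)

data Colour : Set where
  black white : Colour

black? : (c : Colour) → Dec (c ≡ black)
black? black = yes refl
black? white = no λ ()

IsChannel : ∀ {n} → Graph n → Subset n → Set
IsChannel H C = (∀ v → v ∈ C → Vert v) × (∀ v → Vert v → 2 ∣ degreeInto C v)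
  where open Graph H

IsBlackChannel : ∀ {n} → Graph n → (Fin n → Colour) → Subset n → Set
IsBlackChannel H colour C = IsChannel H C × (∀ v → v ∈ C → colour v ≡ black)

isBlackChannel? : ∀ {n} (H : Graph n) (colour : Fin n → Colour) →
                  Decidable (IsBlackChannel H colour)
isBlackChannel? H colour C =
  (all? (λ v → v ∈? C →-dec Vert? v)
    ×-dec all? (λ v → Vert? v →-dec (2 ∣? degreeInto C v)))
  ×-dec all? (λ v → v ∈? C →-dec black? (colour v))
  where open Graph H

𝓒ᴮ : ∀ {n} → Graph n → (Fin n → Colour) → List (Subset n)
𝓒ᴮ {n} H colour = filter (isBlackChannel? H colour) (subsets n)

-- A finite simple graph embedded in the plane, possibly disconnected, given
-- combinatorially.  Each edge e carries two darts (e , true) and (e , false),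
-- its two orientations.  `next` turns a dart counterclockwise about its
-- origin, and `face d` is the face in the angular sector from d to next d,
-- that is, the face to the left of d.
--
-- In a disconnected graph one face can have several boundary walks, so faces
-- are data and not merely orbits of darts.  Let W be the number of boundary
-- walks, an isolated vertex counting as one walk.  Each component has genus
-- ≥ 0, so W ≤ 2·nC − nV + nE.  By faces-connected the incidence graph of
-- components and faces, with one edge per boundary walk, is connected, so
-- W ≥ nC + nF − 1.  The Euler relation makes the two bounds equal: every
-- component is planar and the incidence graph is a tree, which is exactly the
-- condition for the data to come from a drawing on the sphere.  The choice of
-- outerFace turns this into a drawing in the plane.
record PlaneGraph : Set where
  field
    nV nE nF : ℕ

  Vertex : Set
  Vertex = Fin nV

  Edge : Set
  Edge = Fin nE

  Face : Set
  Face = Fin nF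

  Dart : Set
  Dart = Edge × Bool

  rev : Dart → Dart
  rev d = proj₁ d , not (proj₂ d)

  field
    origin      : Dart → Vertex
    no-loop     : ∀ d → origin d ≢ origin (rev d)
    no-parallel : ∀ d d′ → origin d ≡ origin d′ →
                  origin (rev d) ≡ origin (rev d′) → d ≡ d′

    -- Together these make `next` a cyclic permutation of the darts at each
    -- vertex.
    next        : Dart → Dart
    next-origin : ∀ d → origin (next d) ≡ origin d
    next-cyclic : ∀ d d′ → origin d ≡ origin d′ → ∃ λ k → fold d next k ≡ d′

    -- The sector from d to next d lies to the right of next d.
    face        : Dart → Face
    face-sector : ∀ d → face (rev (next d)) ≡ face d

    -- The face containing v when v is isolated; not used for other v.
    isolatedFace : Vertex → Face

    outerFace   : Face

  Adjacent : Rel Vertex 0ℓ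
  Adjacent u v = ∃ λ d → origin d ≡ u × origin (rev d) ≡ v

  AcrossEdge : Rel Face 0ℓ
  AcrossEdge f g = ∃ λ d → face d ≡ f × face (rev d) ≡ g

  field
    nC           : ℕ
    component    : Vertex → Fin nC
    component-⇔  : ∀ u v → component u ≡ component v ⇔ Star Adjacent u v
    component-surjective : Surjective _≡_ _≡_ component

    faces-connected : ∀ f g → Star AcrossEdge f g
    euler           : nV + nF ≡ nE + 1 + nC

  someDart? : {P : Pred Dart 0ℓ} → Decidable P → Dec (∃ P)
  someDart? P? =
    map′ (λ { (e , inj₁ p) → (e , true) , p ; (e , inj₂ p) → (e , false) , p })
         (λ { ((e , true) , p) → e , inj₁ p ; ((e , false) , p) → e , inj₂ p })
         (any? λ e → P? (e , true) ⊎-dec P? (e , false))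

  everyDart? : {P : Pred Dart 0ℓ} → Decidable P → Dec (∀ d → P d)
  everyDart? P? =
    map′ (λ { h (e , true) → proj₁ (h e)
            ; h (e , false) → proj₂ (h e) })
         (λ h e → h (e , true) , h (e , false))
         (all? λ e → P? (e , true) ×-dec P? (e , false))

  Isolated : Pred Vertex 0ℓ
  Isolated v = ∀ d → origin d ≢ v

  -- v lies on the boundary of f.
  Incident : Vertex → Face → Set
  Incident v f = (∃ λ d → origin d ≡ v × face d ≡ f)
               ⊎ (Isolated v × isolatedFace v ≡ f)

  incident? : B.Decidable Incident
  incident? v f =
    someDart? (λ d → (origin d ≟ v) ×-dec (face d ≟ f))
    ⊎-dec (everyDart? (λ d → ¬? (origin d ≟ v)) ×-dec (isolatedFace v ≟ f))

  External Internal : Pred Vertex 0ℓ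
  External v = Incident v outerFace
  Internal v = ¬ External v

  external? : Decidable External
  external? v = incident? v outerFace

  internal? : Decidable Internal
  internal? v = ¬? (external? v)

  graph : Graph nV
  graph = record
    { Vert       = λ _ → ⊤
    ; Vert?      = λ _ → yes _
    ; Adj        = Adjacent
    ; Adj?       = λ u v → someDart? λ d → (origin d ≟ u) ×-dec (origin (rev d) ≟ v)
    ; Adj-Vert   = _
    ; Adj-sym    = λ { ((e , true)  , p , q) → (e , false) , q , p
                     ; ((e , false) , p , q) → (e , true)  , q , p }
    ; Adj-irrefl = λ { (d , refl , q) → no-loop d (sym q) }
    }

  innerSubgraph outerSubgraph : Graph nV
  innerSubgraph = induced graph internal?
  outerSubgraph = induced graph external?

record BipartitePlaneGraph : Set where
  field
    planeGraph : PlaneGraph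
  open PlaneGraph planeGraph public
  field
    colour : Vertex → Colour
    proper : ∀ d → colour (origin d) ≢ colour (origin (rev d))

module _ (G : BipartitePlaneGraph) where
  open BipartitePlaneGraph G
  open Graph graph using (degree)

  InnerSemiEulerian : Set
  InnerSemiEulerian =
    ∀ v → Internal v → colour v ≡ black → 2 ∣ degree v

  -- The sectors around an internal black vertex can be listed as f₁ , … , f₂ₖ
  -- only if k ≥ 1: an isolated vertex has a single sector.  An isolated black
  -- vertex would double the channels of the inner subgraph but not the nests.
  -- Automatic if G is connected and has an edge.
  NoIsolatedInternalBlack : Set
  NoIsolatedInternalBlack =
    ∀ v → Internal v → colour v ≡ black → ¬ Isolated v

  AllSectors NoSectors AlternateSectors : Vertex → Subset nF → Set
  AllSectors b S = ∀ d → origin d ≡ b → face d ∈ S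
  NoSectors  b S = ∀ d → origin d ≡ b → face d ∉ S
  -- With f₁ , f₂ , … the sectors read off from some starting dart d, exactly
  -- f₁ , f₃ , … are in S.  Choosing the neighbouring start gives f₂ , f₄ , ….
  AlternateSectors b S =
    ∃ λ d → origin d ≡ b
          × (∀ (i : Fin (degree b)) → face (fold d next (toℕ i)) ∈ S ⇔ 2 ∣ toℕ i)

  AllInternalFaces NoInternalFaces : Vertex → Subset nF → Set
  AllInternalFaces b S = ∀ f → f ≢ outerFace → Incident b f → f ∈ S
  NoInternalFaces  b S = ∀ f → f ≢ outerFace → Incident b f → f ∉ S

  record IsBilliardNest (S : Subset nF) : Set where
    constructor nest
    field
      internalFaces : outerFace ∉ S
      internalBlack : ∀ b → Internal b → colour b ≡ black →
                      AllSectors b S ⊎ NoSectors b S ⊎ AlternateSectors b S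
      externalBlack : ∀ b → External b → colour b ≡ black →
                      AllInternalFaces b S ⊎ NoInternalFaces b S

  isBilliardNest? : Decidable IsBilliardNest
  isBilliardNest? S =
    map′ (λ { (p , q , r) → nest p q r })
         (λ { (nest p q r) → p , q , r })
         (¬? (outerFace ∈? S) ×-dec
          all? (λ b → internal? b →-dec black? (colour b) →-dec
            (everyDart? (λ d → (origin d ≟ b) →-dec (face d ∈? S))
             ⊎-dec everyDart? (λ d → (origin d ≟ b) →-dec ¬? (face d ∈? S))
             ⊎-dec someDart? (λ d → (origin d ≟ b) ×-dec all? (λ i →
                     (face (fold d next (toℕ i)) ∈? S) ⇔-dec (2 ∣? toℕ i))))) ×-dec
          all? (λ b → external? b →-dec black? (colour b) →-dec
            (all? (λ f → ¬? (f ≟ outerFace) →-dec incident? b f →-dec (f ∈? S))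
             ⊎-dec all? (λ f → ¬? (f ≟ outerFace) →-dec incident? b f →-dec ¬? (f ∈? S)))))

  𝓑 : List (Subset nF)
  𝓑 = filter isBilliardNest? (subsets nF)

{-# OPTIONS --safe #-}

-- Work over 𝔽₂.  For a set S of faces with indicator x, let δ x be the function on edges that is
-- the difference of x across the edge; it is a cycle, i.e. its boundary ∂ (δ x) vanishes at each
-- vertex, and by Euler's relation every cycle is δ x for some x.  A set S of internal faces is a
-- nest iff, away from the outer cycle, δ x is the coboundary of the set C of internal black
-- vertices around which S alternates; ∂ (δ x) = 0 at the internal vertices then says that C is a
-- channel.  Conversely, the coboundary of a channel can be corrected on the outer cycle to a cycle
-- in exactly two ways, which differ by the whole outer cycle.  They are told apart by whether S
-- contains the internal face next to a fixed edge of the outer cycle.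

module Submission where

open import Defs
open import Algebra.Bundles using (CommutativeRing)
import Algebra.Properties.CommutativeSemigroup as CommutativeSemigroup
open import Data.Bool.Base using (Bool; true; false; not; _∧_; _xor_)
open import Data.Bool.Properties as 𝔹 using (xor-assoc; xor-comm; xor-same;
  xor-identityʳ; ∧-distribˡ-xor; ∧-distribʳ-xor; ∧-zeroʳ; ∧-identityʳ; ∧-comm;
  xor-∧-commutativeRing)
open import Data.Fin.Base using (Fin; zero; suc; toℕ; fromℕ; fromℕ<; inject₁; splitAt; join; _↑ˡ_; _↑ʳ_)
open import Data.Fin.Induction using (<-weakInduction)
open import Data.Fin.Properties as 𝔽 using (_≟_; any?; injective⇒≤; toℕ-injective; toℕ-fromℕ;
  toℕ-fromℕ<; toℕ-inject₁; toℕ<n; splitAt-↑ˡ; splitAt-↑ʳ; join-splitAt)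
open import Data.Fin.Subset using (Subset; _∈_; _∉_; inside; outside; ∣_∣; _-_)
open import Data.Fin.Subset.Properties using (_∈?_; x∈p∧x≢y⇒x∈p-y; x∈p⇒∣p-x∣<∣p∣)
open import Data.List.Base as List using (List; []; _∷_; _++_; map; filter; length; allFin; cartesianProduct)
open import Data.List.Membership.Propositional using (lose) renaming (_∈_ to _∈ₗ_)
open import Data.List.Membership.Propositional.Properties
  using (∈-map⁺; ∈-map⁻; ∈-++⁺ˡ; ∈-++⁺ʳ; ∈-allFin; ∈-cartesianProduct⁺; ∈-filter⁺; ∈-filter⁻; ∈-lookup)
open import Data.List.Membership.Setoid.Properties using (index-injective)
open import Data.List.Properties using (length-++; filter-++; filter-notAll)
open import Data.List.Relation.Unary.All as All using (All; []; _∷_)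
open import Data.List.Relation.Unary.AllPairs using ([]; _∷_)
open import Data.List.Relation.Unary.Any using (here; there; index)
open import Data.List.Relation.Unary.Unique.Propositional using (Unique)
open import Data.List.Relation.Unary.Unique.Propositional.Properties
  using (map⁺; ++⁺; filter⁺; allFin⁺; cartesianProduct⁺)
open import Data.Nat.Base using (ℕ; zero; suc; _+_; _*_; _≤_; _<_; z≤n; s≤s; _%_; _/_)
open import Data.Nat.Divisibility using (_∣_; divides)
open import Data.Nat.DivMod using (m%n<n; m<n⇒m%n≡m; n%n≡0; m≡m%n+[m/n]*n)
open import Data.Nat.GeneralisedArithmetic using (fold)
import Data.Nat.Properties as ℕ
open import Data.Nat.Solver using (module +-*-Solver)
open import Data.Product.Base using (∃; ∃₂; _×_; _,_; proj₁; proj₂)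
import Data.Product.Properties as Product
open import Data.Sum.Base using (_⊎_; inj₁; inj₂; [_,_]′)
open import Data.Vec.Base using ([]; _∷_; lookup; tabulate; tail)
open import Data.Vec.Properties using (lookup∘tabulate; tabulate-cong; tabulate∘lookup;
  []=⇒lookup; lookup⇒[]=; ∷-injective; ∷-injectiveʳ; ≡-dec)
open import Function.Base using (_∘_; id)
open import Function.Bundles using (_⇔_; mk⇔; Equivalence)
open import Function.Definitions using (Injective)
open import Level using (0ℓ)
import Relation.Binary.Construct.Closure.ReflexiveTransitive as Star
open Star using (Star; ε; _◅_; _◅◅_; reverse)
open import Relation.Binary.Definitions using (DecidableEquality; tri<; tri≈; tri>)
open import Relation.Binary.PropositionalEquality
open import Relation.Nullary.Decidable
  using (Dec; yes; no; does; ¬?; _×-dec_; _→-dec_; dec-true; dec-false; does-⇔)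
open import Relation.Nullary.Negation using (¬_; contradiction)
open import Relation.Unary using (Pred; Decidable)

-- Bipartiteness drives the reduction: every edge has exactly one black end, so on it the coboundary
-- of a set `C` of black vertices is the indicator of `C` at that end. The nest conditions can
-- therefore be read edge by edge from the black end: `S` changes across every edge at a vertex of
-- `C`, and across no edge off the outer cycle at any other black vertex. The obstacle is the outer
-- cycle itself, where the nest conditions say nothing and the coboundary vanishes although `S` may
-- change. Hence equations are imposed only on edges with an internal end, and the price is a
-- kernel: among sets of internal faces it has dimension one, which is the factor 2. Exactness is
-- obtained by counting unknowns and equations, so disconnected graphs are covered and no topology
-- of curves is used.

private
  variable
    A B : Set
    m n : ℕ

-- Sums and parity over the field of two elements.

module xor = CommutativeSemigroup (CommutativeRing.+-commutativeSemigroup xor-∧-commutativeRing)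

xor≡false⇒≡ : ∀ {a b} → a xor b ≡ false → a ≡ b
xor≡false⇒≡ {false} {false} _ = refl
xor≡false⇒≡ {true}  {true}  _ = refl

does⇒ : {P : Set} (P? : Dec P) → does P? ≡ true → P
does⇒ (yes p) _ = p

bool-ext : ∀ {a b} → (a ≡ true → b ≡ true) → (b ≡ true → a ≡ true) → a ≡ b
bool-ext {false} {false} _ _ = refl
bool-ext {false} {true}  _ g = g refl
bool-ext {true}  {false} f _ = sym (f refl)
bool-ext {true}  {true}  _ _ = refl

⨁ : List A → (A → Bool) → Bool
⨁ []       f = false
⨁ (x ∷ xs) f = f x xor ⨁ xs f

⨁-cong : ∀ (xs : List A) {f g : A → Bool} → f ≗ g → ⨁ xs f ≡ ⨁ xs g
⨁-cong []       f≗g = refl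
⨁-cong (x ∷ xs) f≗g = cong₂ _xor_ (f≗g x) (⨁-cong xs f≗g)

⨁-zero : ∀ (xs : List A) → ⨁ xs (λ _ → false) ≡ false
⨁-zero []       = refl
⨁-zero (x ∷ xs) = ⨁-zero xs

⨁-xor : ∀ (xs : List A) (f g : A → Bool) → ⨁ xs (λ x → f x xor g x) ≡ ⨁ xs f xor ⨁ xs g
⨁-xor []       f g = refl
⨁-xor (x ∷ xs) f g = trans (cong ((f x xor g x) xor_) (⨁-xor xs f g))
                           (xor.interchange (f x) (g x) _ _)

⨁-∧ˡ : ∀ (xs : List A) b (f : A → Bool) → ⨁ xs (λ x → b ∧ f x) ≡ b ∧ ⨁ xs f
⨁-∧ˡ xs false f = ⨁-zero xs
⨁-∧ˡ xs true  f = refl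

⨁-swap : ∀ (xs : List A) (ys : List B) (f : A → B → Bool) →
         ⨁ xs (λ x → ⨁ ys (f x)) ≡ ⨁ ys (λ y → ⨁ xs (λ x → f x y))
⨁-swap []       ys f = sym (⨁-zero ys)
⨁-swap (x ∷ xs) ys f = trans (cong (⨁ ys (f x) xor_) (⨁-swap xs ys f))
                             (sym (⨁-xor ys (f x) _))

⨁-none : ∀ {xs : List A} {f : A → Bool} → All (λ x → f x ≡ false) xs → ⨁ xs f ≡ false
⨁-none []         = refl
⨁-none (px ∷ pxs) = cong₂ _xor_ px (⨁-none pxs)

⨁-single : ∀ {xs : List A} → Unique xs → ∀ {x} → x ∈ₗ xs → ∀ {f} →
           (∀ y → y ≢ x → f y ≡ false) → ⨁ xs f ≡ f x
⨁-single (x∉xs ∷ _) (here refl) {f} f≡0 =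
  trans (cong (f _ xor_) (⨁-none (All.map (λ x≢y → f≡0 _ (x≢y ∘ sym)) x∉xs)))
        (xor-identityʳ _)
⨁-single (y∉xs ∷ u) (there x∈xs) f≡0 =
  cong₂ _xor_ (f≡0 _ (All.lookup y∉xs x∈xs)) (⨁-single u x∈xs f≡0)

⨁ᶠ-single : ∀ (i : Fin n) {f : Fin n → Bool} → (∀ j → j ≢ i → f j ≡ false) →
            ⨁ (allFin n) f ≡ f i
⨁ᶠ-single {n} i = ⨁-single (allFin⁺ n) (∈-allFin i)

odd : ℕ → Bool
odd zero    = false
odd (suc n) = not (odd n)

odd-*2 : ∀ q → odd (q * 2) ≡ false
odd-*2 zero    = refl
odd-*2 (suc q) = cong (not ∘ not) (odd-*2 q)

2∣⇒even : 2 ∣ n → odd n ≡ false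
2∣⇒even (divides q refl) = odd-*2 q

even⇒2∣ : ∀ n → odd n ≡ false → 2 ∣ n
even⇒2∣ zero          _ = divides 0 refl
even⇒2∣ (suc (suc n)) e with even⇒2∣ n (trans (sym (𝔹.not-involutive _)) e)
... | divides q refl = divides (suc q) refl

odd-∣tabulate∣ : ∀ n (f : Fin n → Bool) → odd ∣ tabulate f ∣ ≡ ⨁ (allFin n) f
odd-∣tabulate∣ n f = go n id
  where
  -- Generalised over the reindexing `g`: `allFin n` is `tabulate id`, and its tail is a tabulation
  -- of `suc`.
  go : ∀ m (g : Fin m → Fin n) → odd ∣ tabulate (f ∘ g) ∣ ≡ ⨁ (List.tabulate g) f
  go zero    g = refl
  go (suc m) g with f (g zero)
  ... | true  = cong not (go m (g ∘ suc))
  ... | false = go m (g ∘ suc)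

-- Subsets as bit vectors, and counting them by injections.

∈⇒≡true : ∀ {S : Subset n} {i} → i ∈ S → lookup S i ≡ true
∈⇒≡true = []=⇒lookup

≡true⇒∈ : ∀ {S : Subset n} {i} → lookup S i ≡ true → i ∈ S
≡true⇒∈ {S = S} {i} = lookup⇒[]= i S

∉⇒≡false : ∀ {S : Subset n} {i} → i ∉ S → lookup S i ≡ false
∉⇒≡false i∉S = 𝔹.¬-not (i∉S ∘ ≡true⇒∈)

≡false⇒∉ : ∀ {S : Subset n} {i} → lookup S i ≡ false → i ∉ S
≡false⇒∉ e i∈S with () ← trans (sym e) (∈⇒≡true i∈S)

lookup-ext : ∀ {S T : Subset n} → lookup S ≗ lookup T → S ≡ T
lookup-ext {S = S} {T} eq =
  trans (sym (tabulate∘lookup S)) (trans (tabulate-cong eq) (tabulate∘lookup T))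

∈-subsets : ∀ (S : Subset n) → S ∈ₗ subsets n
∈-subsets []          = here refl
∈-subsets (true  ∷ S) = ∈-++⁺ˡ (∈-map⁺ (inside ∷_) (∈-subsets S))
∈-subsets (false ∷ S) = ∈-++⁺ʳ _ (∈-map⁺ (outside ∷_) (∈-subsets S))

subsets-unique : ∀ n → Unique (subsets n)
subsets-unique zero    = [] ∷ []
subsets-unique (suc n) =
  ++⁺ (map⁺ ∷-injectiveʳ (subsets-unique n)) (map⁺ ∷-injectiveʳ (subsets-unique n)) disjoint
  where
  disjoint : ∀ {S} → ¬ (S ∈ₗ map (inside ∷_) (subsets n) × S ∈ₗ map (outside ∷_) (subsets n))
  disjoint (p , q) with _ , _ , refl ← ∈-map⁻ (inside ∷_) p | _ , _ , () ← ∈-map⁻ (outside ∷_) q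

lookup-injective : ∀ {xs : List A} → Unique xs → Injective _≡_ _≡_ (List.lookup xs)
lookup-injective {xs = _ ∷ _}  _          {zero}  {zero}  _ = refl
lookup-injective {xs = _ ∷ xs} (x∉xs ∷ _) {zero}  {suc j} e = contradiction e (All.lookup x∉xs (∈-lookup j))
lookup-injective {xs = _ ∷ xs} (x∉xs ∷ _) {suc i} {zero}  e = contradiction (sym e) (All.lookup x∉xs (∈-lookup i))
lookup-injective {xs = _ ∷ _}  (_ ∷ u)    {suc i} {suc j} e = cong suc (lookup-injective u e)

-- The pigeonhole principle on positions in the lists. `f` receives the membership proof because the
-- nest built from a channel depends on the proof that it is a channel.
injection⇒length≤ : ∀ {xs : List A} {ys : List B} → Unique xs →
                    (f : ∀ {x} → x ∈ₗ xs → B) → (∀ {x} (p : x ∈ₗ xs) → f p ∈ₗ ys) →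
                    (∀ {x y} (p : x ∈ₗ xs) (q : y ∈ₗ xs) → f p ≡ f q → x ≡ y) →
                    length xs ≤ length ys
injection⇒length≤ {xs = xs} {ys} u f f∈ inj = injective⇒≤ {f = λ i → index (f∈ (∈-lookup {xs = xs} i))}
  λ {i} {j} eq → lookup-injective u
    (inj (∈-lookup i) (∈-lookup j) (index-injective (setoid _) _ _ eq))

module _ {P : Pred (Subset m) 0ℓ} {Q : Pred (Subset n) 0ℓ} (P? : Decidable P) (Q? : Decidable Q) where

  injection⇒∣filter∣≤ : (f : ∀ {S} → P S → Subset n) → (∀ {S} (p : P S) → Q (f p)) →
                        (∀ {S T} (p : P S) (q : P T) → f p ≡ f q → S ≡ T) →
                        length (filter P? (subsets m)) ≤ length (filter Q? (subsets n))
  injection⇒∣filter∣≤ f fQ inj = injection⇒length≤ (filter⁺ P? (subsets-unique m))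
    (f ∘ P∈) (λ p → ∈-filter⁺ Q? (∈-subsets _) (fQ (P∈ p))) (λ p q → inj (P∈ p) (P∈ q))
    where
    P∈ : ∀ {S} → S ∈ₗ filter P? (subsets m) → P S
    P∈ = proj₂ ∘ ∈-filter⁻ P? {xs = subsets m}

-- If `T` were missed, `f` would inject all subsets into the strictly shorter list of those
-- different from `T`.
injective⇒surjective : ∀ (f : Subset n → Subset n) → Injective _≡_ _≡_ f → ∀ T → ∃ λ S → f S ≡ T
injective⇒surjective {n} f inj T with any⊎none (subsets n)
  where
  any⊎none : ∀ Ss → (∃ λ S → f S ≡ T) ⊎ All (λ S → f S ≢ T) Ss
  any⊎none [] = inj₂ []
  any⊎none (S ∷ Ss) with ≡-dec 𝔹._≟_ (f S) T | any⊎none Ss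
  ... | yes e | _      = inj₁ (S , e)
  ... | no _  | inj₁ p = inj₁ p
  ... | no ¬e | inj₂ p = inj₂ (¬e ∷ p)
... | inj₁ p = p
... | inj₂ miss = contradiction
  (injection⇒length≤ (subsets-unique n) (λ {S} _ → f S)
    (λ p → ∈-filter⁺ ≢T? (∈-subsets _) (All.lookup miss p)) (λ _ _ → inj))
  (ℕ.<⇒≱ (filter-notAll ≢T? (subsets n) (lose (∈-subsets T) (λ ne → ne refl))))
  where
  ≢T? : Decidable (_≢ T)
  ≢T? S = ¬? (≡-dec 𝔹._≟_ S T)

-- Finiteness replaces dimension theory: a trivial kernel makes `L` injective, and an injective
-- self-map of a finite set is onto. Squareness is an equation between `m` and `n` so that Euler's
-- relation can be supplied as it is.
linear-surjective : m ≡ n → (L : (Fin m → Bool) → Fin n → Bool) →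
  (∀ {x y} → x ≗ y → L x ≗ L y) →
  (∀ x y j → L (λ i → x i xor y i) j ≡ L x j xor L y j) →
  (∀ x → (∀ j → L x j ≡ false) → ∀ i → x i ≡ false) →
  ∀ y → ∃ λ x → L x ≗ y
linear-surjective refl L L-cong L-xor kernel y =
  lookup S , λ j → trans (sym (lookup∘tabulate _ j)) (trans (cong (λ T → lookup T j) fS≡y) (lookup∘tabulate y j))
  where
  f : Subset _ → Subset _
  f S = tabulate (L (lookup S))
  inj : Injective _≡_ _≡_ f
  inj {S} {T} eq = lookup-ext λ i → xor≡false⇒≡ (kernel _ (λ j → trans (L-xor _ _ j)
    (trans (cong (_xor L (lookup T) j) (L≗ j)) (xor-same (L (lookup T) j)))) i)
    where
    L≗ : L (lookup S) ≗ L (lookup T)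
    L≗ j = trans (sym (lookup∘tabulate _ j)) (trans (cong (λ T → lookup T j) eq) (lookup∘tabulate _ j))
  S    = proj₁ (injective⇒surjective f inj (tabulate y))
  fS≡y = proj₂ (injective⇒surjective f inj (tabulate y))

injection⇒≤∣p∣ : ∀ m (S : Subset n) (f : Fin m → Fin n) → Injective _≡_ _≡_ f →
                 (∀ i → f i ∈ S) → m ≤ ∣ S ∣
injection⇒≤∣p∣ zero    S f inj f∈ = z≤n
injection⇒≤∣p∣ (suc m) S f inj f∈ = ℕ.≤-trans
  (s≤s (injection⇒≤∣p∣ m (S - f zero) (f ∘ suc) (𝔽.suc-injective ∘ inj)
     (λ i → x∈p∧x≢y⇒x∈p-y (f∈ (suc i)) (λ e → 0≢suc (sym (inj e))))))
  (x∈p⇒∣p-x∣<∣p∣ (f∈ zero))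
  where
  0≢suc : ∀ {i : Fin m} → zero ≢ suc i
  0≢suc ()

∈⇔2∣⇒parity : ∀ {S : Subset n} {i} m → (i ∈ S ⇔ 2 ∣ m) → lookup S i ≡ not (odd m)
∈⇔2∣⇒parity m e with odd m in eq
... | true  = ∉⇒≡false λ i∈S → contradiction (trans (sym eq) (2∣⇒even (Equivalence.to e i∈S))) λ ()
... | false = ∈⇒≡true (Equivalence.from e (even⇒2∣ m eq))

parity⇒∈⇔2∣ : ∀ {S : Subset n} {i} m → lookup S i ≡ not (odd m) → i ∈ S ⇔ 2 ∣ m
parity⇒∈⇔2∣ m e = mk⇔
  (λ i∈S → even⇒2∣ m (𝔹.not-injective (trans (sym e) (∈⇒≡true i∈S))))
  (λ 2∣m → ≡true⇒∈ (trans e (cong not (2∣⇒even 2∣m))))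

-- The source of the factor 2: the head is a free bit, which will record membership of `innerFace`,
-- and the tail will be the channel.
length-filter-tail : ∀ {P : Pred (Subset n) 0ℓ} (P? : Decidable P) →
                     length (filter (P? ∘ tail) (subsets (suc n))) ≡ 2 * length (filter P? (subsets n))
length-filter-tail {n} P? = begin
  length (filter (P? ∘ tail) (subsets (suc n)))
    ≡⟨ cong length (filter-++ (P? ∘ tail) (map (inside ∷_) (subsets n)) _) ⟩
  length (filter (P? ∘ tail) (map (inside ∷_) (subsets n)) ++ filter (P? ∘ tail) (map (outside ∷_) (subsets n)))
    ≡⟨ length-++ (filter (P? ∘ tail) (map (inside ∷_) (subsets n))) ⟩
  length (filter (P? ∘ tail) (map (inside ∷_) (subsets n)))
    + length (filter (P? ∘ tail) (map (outside ∷_) (subsets n)))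
    ≡⟨ cong₂ _+_ (go inside (subsets n)) (trans (go outside (subsets n)) (sym (ℕ.+-identityʳ _))) ⟩
  2 * length (filter P? (subsets n)) ∎
  where
  open ≡-Reasoning
  go : ∀ β Ss → length (filter (P? ∘ tail) (map (β ∷_) Ss)) ≡ length (filter P? Ss)
  go β []       = refl
  go β (S ∷ Ss) with does (P? S)
  ... | true  = cong suc (go β Ss)
  ... | false = go β Ss

-- Chains, boundaries and exactness on a plane graph.

module Homology (G : PlaneGraph) where
  open PlaneGraph G
  open ≡-Reasoning

  _≟ᵈ_ : DecidableEquality Dart
  _≟ᵈ_ = Product.≡-dec _≟_ 𝔹._≟_

  darts : List Dart
  darts = cartesianProduct (allFin nE) (true ∷ false ∷ [])

  ⨁ᵈ-single : ∀ d {f : Dart → Bool} → (∀ e → e ≢ d → f e ≡ false) → ⨁ darts f ≡ f d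
  ⨁ᵈ-single (e , b) = ⨁-single
    (cartesianProduct⁺ (allFin⁺ nE) (((λ ()) ∷ []) ∷ [] ∷ []))
    (∈-cartesianProduct⁺ (∈-allFin e) (∈-Bool b))
    where
    ∈-Bool : ∀ b → b ∈ₗ true ∷ false ∷ []
    ∈-Bool true  = here refl
    ∈-Bool false = there (here refl)

  rev-involutive : ∀ d → rev (rev d) ≡ d
  rev-involutive (e , b) = cong (e ,_) (𝔹.not-involutive b)

  rev-≢ : ∀ d → rev d ≢ d
  rev-≢ (_ , true)  ()
  rev-≢ (_ , false) ()

  same-edge : ∀ d e → proj₁ d ≡ proj₁ e → d ≡ e ⊎ d ≡ rev e
  same-edge (_ , true)  (_ , true)  refl = inj₁ refl
  same-edge (_ , true)  (_ , false) refl = inj₂ refl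
  same-edge (_ , false) (_ , true)  refl = inj₂ refl
  same-edge (_ , false) (_ , false) refl = inj₁ refl

  ⨁-symmetric : ∀ {y : Dart → Bool} → (∀ d → y (rev d) ≡ y d) → ⨁ darts y ≡ false
  ⨁-symmetric {y} sy = go (allFin nE)
    where
    go : ∀ es → ⨁ (cartesianProduct es (true ∷ false ∷ [])) y ≡ false
    go []       = refl
    go (e ∷ es) = begin
      y (e , true) xor (y (e , false) xor _) ≡⟨ xor-assoc (y (e , true)) _ _ ⟨
      (y (e , true) xor y (e , false)) xor _
        ≡⟨ cong₂ _xor_ (trans (cong (y (e , true) xor_) (sy (e , true))) (xor-same (y (e , true)))) (go es) ⟩
      false                                  ∎

  fold-next : ∀ d k → fold (next d) next k ≡ next (fold d next k)
  fold-next d zero    = refl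
  fold-next d (suc k) = cong next (fold-next d k)

  fold-+ : ∀ d j k → fold d next (j + k) ≡ fold (fold d next k) next j
  fold-+ d zero    k = refl
  fold-+ d (suc j) k = cong next (fold-+ d j k)

  fold-* : ∀ d p q → fold d next p ≡ d → fold d next (q * p) ≡ d
  fold-* d p zero    eq = refl
  fold-* d p (suc q) eq = trans (fold-+ d p (q * p)) (trans (cong (λ e → fold e next p) (fold-* d p q eq)) eq)

  origin-fold : ∀ d k → origin (fold d next k) ≡ origin d
  origin-fold d zero    = refl
  origin-fold d (suc k) = trans (next-origin _) (origin-fold d k)

  period : ∀ d → ∃ λ k → fold d next (suc k) ≡ d
  period d with k , eq ← next-cyclic (next d) d (next-origin d) = k , trans (sym (fold-next d k)) eq

  next-surjective : ∀ d → ∃ λ e → next e ≡ d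
  next-surjective d with k , eq ← period d = fold d next k , eq

  -- A dart is recovered from c = next d as the l-th successor of c, for some l with period
  -- 1 + l; two such numbers l and l′ both reach the successor of index l + l′ + l l′.
  next-injective : ∀ {d e} → next d ≡ next e → d ≡ e
  next-injective {d} {e} eq
    with l  , p ← next-cyclic (next d) d (next-origin d)
       | l′ , q ← next-cyclic (next e) e (next-origin e) = begin
    d                                      ≡⟨ p ⟨
    fold c next l                          ≡⟨ cong (λ z → fold z next l) (fold-* c (suc l) l′ (cong next p)) ⟨
    fold (fold c next (l′ * suc l)) next l ≡⟨ fold-+ c l _ ⟨
    fold c next (l + l′ * suc l)
      ≡⟨ cong (fold c next) (solve 2 (λ l l′ → l :+ l′ :* (con 1 :+ l) := l′ :+ l :* (con 1 :+ l′)) refl l l′) ⟩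
    fold c next (l′ + l * suc l′)          ≡⟨ cong (λ z → fold z next (l′ + l * suc l′)) eq ⟩
    fold (next e) next (l′ + l * suc l′)   ≡⟨ fold-+ (next e) l′ _ ⟩
    fold (fold (next e) next (l * suc l′)) next l′
      ≡⟨ cong (λ z → fold z next l′) (fold-* (next e) (suc l′) l (cong next q)) ⟩
    fold (next e) next l′                  ≡⟨ q ⟩
    e                                      ∎
    where
    c = next d
    open +-*-Solver

  -- Each `f (next d)` is spread out as a sum over `e` against the indicator of `e ≡ next d`; after
  -- the two sums are swapped, exactly one `d` remains for each `e`, as `next` is a bijection.
  ⨁-next : ∀ (f : Dart → Bool) → ⨁ darts (f ∘ next) ≡ ⨁ darts f
  ⨁-next f = begin
    ⨁ darts (f ∘ next)
      ≡⟨ ⨁-cong darts (λ d → trans (⨁ᵈ-single (next d) {λ e → f e ∧ does (e ≟ᵈ next d)}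
           (λ e ne → trans (cong (f e ∧_) (dec-false (e ≟ᵈ next d) ne)) (∧-zeroʳ _)))
           (trans (cong (f (next d) ∧_) (dec-true (next d ≟ᵈ next d) refl)) (∧-identityʳ _))) ⟨
    ⨁ darts (λ d → ⨁ darts (λ e → f e ∧ does (e ≟ᵈ next d)))
      ≡⟨ ⨁-swap darts darts _ ⟩
    ⨁ darts (λ e → ⨁ darts (λ d → f e ∧ does (e ≟ᵈ next d)))
      ≡⟨ ⨁-cong darts only ⟩
    ⨁ darts f ∎
    where
    only : ∀ e → ⨁ darts (λ d → f e ∧ does (e ≟ᵈ next d)) ≡ f e
    only e with d₀ , refl ← next-surjective e = trans
      (⨁ᵈ-single d₀ (λ d ne → trans
        (cong (f e ∧_) (dec-false (next d₀ ≟ᵈ next d) (λ eq → ne (next-injective (sym eq))))) (∧-zeroʳ _)))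
      (trans (cong (f e ∧_) (dec-true (next d₀ ≟ᵈ next d₀) refl)) (∧-identityʳ _))

  -- Defined for all functions on darts, symmetric under `rev` or not: one-sided functions such as
  -- `x ∘ face` and indicators of single darts occur as intermediate terms.
  ∂ : (Dart → Bool) → Vertex → Bool
  ∂ y v = ⨁ darts λ d → does (origin d ≟ v) ∧ y d

  δ : (Face → Bool) → Dart → Bool
  δ x d = x (face d) xor x (face (rev d))

  δ-rev : ∀ x d → δ x (rev d) ≡ δ x d
  δ-rev x d = trans (cong (λ e → x (face (rev d)) xor x (face e)) (rev-involutive d)) (xor-comm (x (face (rev d))) _)

  δ-xor : ∀ x x′ d → δ (λ f → x f xor x′ f) d ≡ δ x d xor δ x′ d
  δ-xor x x′ d = xor.interchange (x (face d)) _ _ _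

  ∂-cong : ∀ {y y′} v → (∀ d → origin d ≡ v → y d ≡ y′ d) → ∂ y v ≡ ∂ y′ v
  ∂-cong {y} {y′} v eq = ⨁-cong darts at
    where
    at : ∀ d → does (origin d ≟ v) ∧ y d ≡ does (origin d ≟ v) ∧ y′ d
    at d with origin d ≟ v
    ... | yes o = eq d o
    ... | no  _ = refl

  ∂-zero : ∀ {y} v → (∀ d → origin d ≡ v → y d ≡ false) → ∂ y v ≡ false
  ∂-zero v eq = trans (∂-cong v eq) (trans (⨁-cong darts (λ _ → ∧-zeroʳ _)) (⨁-zero darts))

  ∂-xor : ∀ y y′ v → ∂ (λ d → y d xor y′ d) v ≡ ∂ y v xor ∂ y′ v
  ∂-xor y y′ v = trans (⨁-cong darts (λ d → ∧-distribˡ-xor (does (origin d ≟ v)) _ _)) (⨁-xor darts _ _)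

  ∂-∧ : ∀ b y v → ∂ (λ d → b ∧ y d) v ≡ b ∧ ∂ y v
  ∂-∧ false y v = ∂-zero v (λ _ _ → refl)
  ∂-∧ true  y v = refl

  ∂-⨁ : ∀ {A : Set} (xs : List A) (y : A → Dart → Bool) v →
        ∂ (λ d → ⨁ xs (λ a → y a d)) v ≡ ⨁ xs (λ a → ∂ (y a) v)
  ∂-⨁ xs y v = trans (⨁-cong darts (λ d → sym (⨁-∧ˡ xs (does (origin d ≟ v)) _))) (⨁-swap darts xs _)

  ∂-point : ∀ e v → ∂ (λ d → does (d ≟ᵈ e)) v ≡ does (origin e ≟ v)
  ∂-point e v = trans
    (⨁ᵈ-single e (λ d ne → trans (cong (does (origin d ≟ v) ∧_) (dec-false (d ≟ᵈ e) ne)) (∧-zeroʳ _)))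
    (trans (cong (does (origin e ≟ v) ∧_) (dec-true (e ≟ᵈ e) refl)) (∧-identityʳ _))

  -- Each sector at `v` is counted twice, from its two bounding darts; rotating by `next` carries
  -- one half of the sum into the other.
  ∂δ : ∀ x v → ∂ (δ x) v ≡ false
  ∂δ x v = begin
    ∂ (δ x) v                                        ≡⟨ ∂-xor _ _ v ⟩
    ∂ (x ∘ face) v xor ∂ (x ∘ face ∘ rev) v          ≡⟨ cong (∂ (x ∘ face) v xor_) (⨁-next _) ⟨
    ∂ (x ∘ face) v xor _                             ≡⟨ cong (∂ (x ∘ face) v xor_) (⨁-cong darts λ d →
                                                          cong₂ (λ u f → does (u ≟ v) ∧ x f) (next-origin d) (face-sector d)) ⟩
    ∂ (x ∘ face) v xor ∂ (x ∘ face) v                ≡⟨ xor-same (∂ (x ∘ face) v) ⟩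
    false                                            ∎

  -- The handshake argument: each edge contributes its value once at either end.
  ⨁-∂ : ∀ {y} → (∀ d → y (rev d) ≡ y d) → ⨁ (allFin nV) (∂ y) ≡ false
  ⨁-∂ {y} sy = begin
    ⨁ (allFin nV) (∂ y)                                                   ≡⟨ ⨁-swap (allFin nV) darts _ ⟩
    ⨁ darts (λ d → ⨁ (allFin nV) (λ v → does (origin d ≟ v) ∧ y d))       ≡⟨ ⨁-cong darts (λ d → trans
        (⨁ᶠ-single (origin d) (λ v ne → cong (_∧ y d) (dec-false (origin d ≟ v) (ne ∘ sym))))
        (cong (_∧ y d) (dec-true (origin d ≟ origin d) refl))) ⟩
    ⨁ darts y                                                             ≡⟨ ⨁-symmetric sy ⟩
    false                                                                 ∎

  -- Traversals are counted mod 2 and per edge rather than per dart, so `walk p ∘ proj₁` is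
  -- symmetric under `rev` by construction.
  walk : ∀ {u v} → Star Adjacent u v → Edge → Bool
  walk ε             e = false
  walk ((d , _) ◅ p) e = does (e ≟ proj₁ d) xor walk p e

  ∂-walk : ∀ {u v} (p : Star Adjacent u v) w → ∂ (walk p ∘ proj₁) w ≡ does (u ≟ w) xor does (v ≟ w)
  ∂-walk {u} ε w = trans (∂-zero w (λ _ _ → refl)) (sym (xor-same (does (u ≟ w))))
  ∂-walk {u} {v} ((d , refl , refl) ◅ p) w = begin
    ∂ (λ e → does (proj₁ e ≟ proj₁ d) xor walk p (proj₁ e)) w
      ≡⟨ ∂-xor _ _ w ⟩
    ∂ (λ e → does (proj₁ e ≟ proj₁ d)) w xor ∂ (walk p ∘ proj₁) w
      ≡⟨ cong₂ _xor_ (trans (∂-cong w (λ e _ → edge e))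
            (trans (∂-xor _ _ w) (cong₂ _xor_ (∂-point d w) (∂-point (rev d) w)))) (∂-walk p w) ⟩
    (a xor b) xor (b xor c)
      ≡⟨ trans (xor-assoc a b _) (cong (a xor_) (trans (sym (xor-assoc b b c)) (cong (_xor c) (xor-same b)))) ⟩
    a xor c ∎
    where
    a = does (origin d ≟ w)
    b = does (origin (rev d) ≟ w)
    c = does (v ≟ w)
    edge : ∀ e → does (proj₁ e ≟ proj₁ d) ≡ does (e ≟ᵈ d) xor does (e ≟ᵈ rev d)
    edge e with e ≟ᵈ d
    ... | yes refl = trans (dec-true (proj₁ e ≟ proj₁ e) refl)
        (cong not (sym (dec-false (e ≟ᵈ rev e) (λ eq → rev-≢ e (sym eq)))))
    ... | no e≢d   = does-⇔ (mk⇔ to (cong proj₁)) (proj₁ e ≟ proj₁ d) (e ≟ᵈ rev d)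
      where
      to : proj₁ e ≡ proj₁ d → e ≡ rev d
      to eq with same-edge e d eq
      ... | inj₁ e≡d = contradiction e≡d e≢d
      ... | inj₂ e≡r = e≡r

  -- Used with paths to the roots of the components, and again with paths along the outer cycle to a
  -- base point.
  combine : (Vertex → Edge → Bool) → (Vertex → Bool) → Edge → Bool
  combine P g e = ⨁ (allFin nV) (λ v → g v ∧ P v e)

  -- The assumption on `P v` is restricted to the selected `v` because paths along the outer cycle
  -- exist only for external vertices.
  ∂-combine : ∀ P (r : Vertex → Vertex) g →
    (∀ v → g v ≡ true → ∀ w → ∂ (P v ∘ proj₁) w ≡ does (v ≟ w) xor does (r v ≟ w)) →
    ∀ w → ∂ (combine P g ∘ proj₁) w ≡ g w xor ⨁ (allFin nV) (λ v → g v ∧ does (r v ≟ w))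
  ∂-combine P r g ∂P w = begin
    ∂ (combine P g ∘ proj₁) w
      ≡⟨ ∂-⨁ (allFin nV) (λ v d → g v ∧ P v (proj₁ d)) w ⟩
    ⨁ (allFin nV) (λ v → ∂ (λ d → g v ∧ P v (proj₁ d)) w)
      ≡⟨ ⨁-cong (allFin nV) (λ v → trans (∂-∧ (g v) _ w) (trans (step v) (∧-distribˡ-xor (g v) _ _))) ⟩
    ⨁ (allFin nV) (λ v → (g v ∧ does (v ≟ w)) xor (g v ∧ does (r v ≟ w)))
      ≡⟨ ⨁-xor (allFin nV) _ _ ⟩
    ⨁ (allFin nV) (λ v → g v ∧ does (v ≟ w)) xor _
      ≡⟨ cong (_xor ⨁ (allFin nV) (λ v → g v ∧ does (r v ≟ w))) (trans
           (⨁ᶠ-single w (λ v ne → trans (cong (g v ∧_) (dec-false (v ≟ w) ne)) (∧-zeroʳ _)))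
           (trans (cong (g w ∧_) (dec-true (w ≟ w) refl)) (∧-identityʳ _))) ⟩
    g w xor _ ∎
    where
    step : ∀ v → g v ∧ ∂ (P v ∘ proj₁) w ≡ g v ∧ (does (v ≟ w) xor does (r v ≟ w))
    step v with g v in gv
    ... | true  = ∂P v gv w
    ... | false = refl

  combine-cong : ∀ P {g g′} → g ≗ g′ → combine P g ≗ combine P g′
  combine-cong P eq e = ⨁-cong (allFin nV) (λ v → cong (_∧ P v e) (eq v))

  combine-xor : ∀ P g g′ e → combine P (λ v → g v xor g′ v) e ≡ combine P g e xor combine P g′ e
  combine-xor P g g′ e = trans (⨁-cong (allFin nV) (λ v → ∧-distribʳ-xor (P v e) (g v) (g′ v))) (⨁-xor (allFin nV) _ _)

  δ≡0⇒constant : ∀ {x} → (∀ d → δ x d ≡ false) → ∀ f g → x f ≡ x g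
  δ≡0⇒constant {x} δ≡0 f g = go (faces-connected f g)
    where
    go : ∀ {f g} → Star AcrossEdge f g → x f ≡ x g
    go ε                       = refl
    go ((d , refl , refl) ◅ p) = trans (xor≡false⇒≡ (δ≡0 d)) (go p)

  -- Every closed chain is a difference of faces.

  root : Fin nC → Vertex
  root c = proj₁ (component-surjective c)

  component-root : ∀ c → component (root c) ≡ c
  component-root c = proj₂ (component-surjective c) refl

  rootOf : Vertex → Vertex
  rootOf v = root (component v)

  rootPath : ∀ v → Star Adjacent v (rootOf v)
  rootPath v = Equivalence.to (component-⇔ v (rootOf v)) (sym (component-root (component v)))

  toRoot : Vertex → Edge → Bool
  toRoot v = walk (rootPath v)

  -- No path ends at a vertex that is not a root, so the boundary there is `g` itself.
  combine-toRoot-injective : ∀ {g} → (∀ c → g (root c) ≡ false) →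
    (∀ v → ∂ (combine toRoot g ∘ proj₁) v ≡ false) → ∀ v → g v ≡ false
  combine-toRoot-injective {g} g≡0 ∂≡0 v with rootOf v ≟ v
  ... | yes eq = trans (cong g (sym eq)) (g≡0 (component v))
  ... | no  ne = begin
    g v            ≡⟨ xor-identityʳ (g v) ⟨
    g v xor false  ≡⟨ cong (g v xor_) (trans (⨁-cong (allFin nV) (λ u → trans
                        (cong (g u ∧_) (dec-false (rootOf u ≟ v) (λ { refl → ne (cong root (component-root _)) }))) (∧-zeroʳ _)))
                        (⨁-zero (allFin nV))) ⟨
    g v xor _      ≡⟨ ∂-combine toRoot rootOf g (λ v _ → ∂-walk (rootPath v)) v ⟨
    _              ≡⟨ ∂≡0 v ⟩
    false          ∎

  private
    verts : (Fin (nV + nF) → Bool) → Vertex → Bool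
    verts h v = h (v ↑ˡ nF)

    faces : (Fin (nV + nF) → Bool) → Face → Bool
    faces h f = h (nV ↑ʳ f)

    chain : (Fin (nV + nF) → Bool) → Dart → Bool
    chain h d = δ (faces h) d xor combine toRoot (verts h) (proj₁ d)

    -- The last two kinds of equations remove the redundancies: constants lie in the kernel of `δ`,
    -- and the path chosen for a root is closed, hence has no boundary.
    value : (Fin (nV + nF) → Bool) → (Fin nE ⊎ Fin 1) ⊎ Fin nC → Bool
    value h (inj₁ (inj₁ e)) = chain h (e , true)
    value h (inj₁ (inj₂ _)) = faces h outerFace
    value h (inj₂ c)        = verts h (root c)

    split : Fin (nE + 1 + nC) → (Fin nE ⊎ Fin 1) ⊎ Fin nC
    split = [ inj₁ ∘ splitAt nE , inj₂ ]′ ∘ splitAt (nE + 1)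

    unsplit : (Fin nE ⊎ Fin 1) ⊎ Fin nC → Fin (nE + 1 + nC)
    unsplit (inj₁ s) = join nE 1 s ↑ˡ nC
    unsplit (inj₂ c) = (nE + 1) ↑ʳ c

    split-unsplit : ∀ s → split (unsplit s) ≡ s
    split-unsplit (inj₁ s) rewrite splitAt-↑ˡ (nE + 1) (join nE 1 s) nC = cong inj₁ (𝔽.splitAt-join nE 1 s)
    split-unsplit (inj₂ c) rewrite splitAt-↑ʳ (nE + 1) nC c = refl

    system : (Fin (nV + nF) → Bool) → Fin (nE + 1 + nC) → Bool
    system h = value h ∘ split

    value-cong : ∀ {h h′} → h ≗ h′ → value h ≗ value h′
    value-cong eq (inj₁ (inj₁ e)) = cong₂ _xor_ (cong₂ _xor_ (eq _) (eq _)) (combine-cong toRoot (λ _ → eq _) e)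
    value-cong eq (inj₁ (inj₂ _)) = eq _
    value-cong eq (inj₂ c)        = eq _

    value-xor : ∀ h h′ s → value (λ i → h i xor h′ i) s ≡ value h s xor value h′ s
    value-xor h h′ (inj₁ (inj₁ e)) = trans
      (cong₂ _xor_ (δ-xor (faces h) (faces h′) (e , true)) (combine-xor toRoot (verts h) (verts h′) e))
      (xor.interchange (δ (faces h) (e , true)) _ _ _)
    value-xor h h′ (inj₁ (inj₂ _)) = refl
    value-xor h h′ (inj₂ c)        = refl

    chain-symmetric : ∀ h d → chain h (rev d) ≡ chain h d
    chain-symmetric h d = cong (_xor combine toRoot (verts h) (proj₁ d)) (δ-rev (faces h) d)

    symmetric-ext : ∀ {y y′ : Dart → Bool} → (∀ d → y (rev d) ≡ y d) → (∀ d → y′ (rev d) ≡ y′ d) →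
                    (∀ e → y (e , true) ≡ y′ (e , true)) → y ≗ y′
    symmetric-ext sy sy′ eq (e , true)  = eq e
    symmetric-ext sy sy′ eq (e , false) = trans (sy (e , true)) (trans (eq e) (sym (sy′ (e , true))))

    -- As `δ` has no boundary, that of the chain comes from the paths alone. This serves both for
    -- the kernel and for the solution with closed right-hand side, where only the `δ` term is left.
    closed⇒verts≡0 : ∀ h → (∀ c → verts h (root c) ≡ false) → (∀ v → ∂ (chain h) v ≡ false) →
                     ∀ v → verts h v ≡ false
    closed⇒verts≡0 h roots closed = combine-toRoot-injective {verts h} roots λ v →
      trans (sym (cong (_xor ∂ (combine toRoot (verts h) ∘ proj₁) v) (∂δ (faces h) v)))
            (trans (sym (∂-xor (δ (faces h)) _ v)) (closed v))

    chain≗δ : ∀ h → (∀ v → verts h v ≡ false) → chain h ≗ δ (faces h)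
    chain≗δ h v≡0 d = trans
      (cong (δ (faces h) d xor_) (trans (combine-cong toRoot v≡0 (proj₁ d)) (⨁-zero (allFin nV))))
      (xor-identityʳ _)

    -- The zero chain is closed, so the vertex coefficients vanish; what remains is a function on
    -- faces without jumps, constant because the faces are connected and zero at `outerFace`.
    system-kernel : ∀ h → (∀ j → system h j ≡ false) → ∀ i → h i ≡ false
    system-kernel h sys≡0 i = trans (cong h (sym (join-splitAt nV nF i))) (zeroes (splitAt nV i))
      where
      value≡0 : ∀ s → value h s ≡ false
      value≡0 s = trans (cong (value h) (sym (split-unsplit s))) (sys≡0 (unsplit s))
      chain≡0 : ∀ d → chain h d ≡ false
      chain≡0 = symmetric-ext (chain-symmetric h) (λ _ → refl) (value≡0 ∘ inj₁ ∘ inj₁)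
      verts≡0 : ∀ v → verts h v ≡ false
      verts≡0 = closed⇒verts≡0 h (value≡0 ∘ inj₂) (λ v → ∂-zero v (λ d _ → chain≡0 d))
      zeroes : ∀ s → h (join nV nF s) ≡ false
      zeroes (inj₁ v) = verts≡0 v
      zeroes (inj₂ f) = trans
        (δ≡0⇒constant {faces h} (λ d → trans (sym (chain≗δ h verts≡0 d)) (chain≡0 d)) f outerFace)
        (value≡0 (inj₁ (inj₂ zero)))

  -- The square linear system (x , g) ↦ (δ x + Σ g(v) toRoot v , x outerFace , g ∘ root) has
  -- trivial kernel, and Euler's relation says precisely that it is square.
  closed⇒exact : ∀ y → (∀ d → y (rev d) ≡ y d) → (∀ v → ∂ y v ≡ false) →
                 ∃ λ x → x outerFace ≡ false × δ x ≗ y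
  closed⇒exact y sy closed = faces h , value≡ (inj₁ (inj₂ zero)) , λ d →
    trans (sym (chain≗δ h (closed⇒verts≡0 h (value≡ ∘ inj₂)
            (λ v → trans (∂-cong v (λ d _ → chain≡ d)) (closed v))) d)) (chain≡ d)
    where
    target : (Fin nE ⊎ Fin 1) ⊎ Fin nC → Bool
    target (inj₁ (inj₁ e)) = y (e , true)
    target (inj₁ (inj₂ _)) = false
    target (inj₂ _)        = false
    solution = linear-surjective euler system (λ eq j → value-cong eq (split j))
                 (λ h h′ j → value-xor h h′ (split j)) system-kernel (target ∘ split)
    h = proj₁ solution
    value≡ : ∀ s → value h s ≡ target s
    value≡ s = trans (cong (value h) (sym (split-unsplit s)))
                     (trans (proj₂ solution (unsplit s)) (cong target (split-unsplit s)))
    chain≡ : ∀ d → chain h d ≡ y d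
    chain≡ = symmetric-ext (chain-symmetric h) sy (value≡ ∘ inj₁ ∘ inj₁)

-- Successors in a cyclic order.

module Arcs (k : ℕ) where

  -- Unfolds to the same proposition as `Next`, which is local to `IsSimpleCycle`.
  Arc : Fin (3 + k) → Fin (3 + k) → Set
  Arc i j = toℕ j ≡ suc (toℕ i) % (3 + k)

  arc-cases : ∀ {i j} → Arc i j → toℕ j ≡ suc (toℕ i) ⊎ (toℕ j ≡ 0 × toℕ i ≡ 2 + k)
  arc-cases {i} eq with ℕ.m≤n⇒m<n∨m≡n (toℕ<n i)
  ... | inj₁ i+1<n = inj₁ (trans eq (m<n⇒m%n≡m i+1<n))
  ... | inj₂ i+1≡n = inj₂ (trans eq (trans (cong (_% (3 + k)) i+1≡n) (n%n≡0 (3 + k))) , ℕ.suc-injective i+1≡n)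

  arc-functional : ∀ {i j j′} → Arc i j → Arc i j′ → j ≡ j′
  arc-functional p q = toℕ-injective (trans p (sym q))

  arc-injective : ∀ {i i′ j} → Arc i j → Arc i′ j → i ≡ i′
  arc-injective {i} {i′} {j} p q with arc-cases {i} {j} p | arc-cases {i′} {j} q
  ... | inj₁ a       | inj₁ b       = toℕ-injective (ℕ.suc-injective (trans (sym a) b))
  ... | inj₁ a       | inj₂ (b , _) = contradiction (trans (sym a) b) λ ()
  ... | inj₂ (a , _) | inj₁ b       = contradiction (trans (sym b) a) λ ()
  ... | inj₂ (_ , a) | inj₂ (_ , b) = toℕ-injective (trans a (sym b))

  -- Opposite arcs would close up a cycle of length 2, but the length is at least 3.
  arc-asymmetric : ∀ {i j} → Arc i j → ¬ Arc j i
  arc-asymmetric {i} {j} p q with arc-cases {i} {j} p | arc-cases {j} {i} q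
  ... | inj₁ a       | inj₁ b       = ℕ.<-asym (ℕ.≤-reflexive (sym a)) (ℕ.≤-reflexive (sym b))
  ... | inj₁ a       | inj₂ (b , c) = contradiction (trans (sym c) (trans a (cong suc b))) λ ()
  ... | inj₂ (a , b) | inj₁ c       = contradiction (trans (sym b) (trans c (cong suc a))) λ ()
  ... | inj₂ (a , _) | inj₂ (_ , b) = contradiction (trans (sym a) b) λ ()

  arc-successor : ∀ i → ∃ (Arc i)
  arc-successor i = fromℕ< (m%n<n (suc (toℕ i)) (3 + k)) , toℕ-fromℕ< _

  arc-inject₁ : ∀ (i : Fin (2 + k)) → Arc (inject₁ i) (suc i)
  arc-inject₁ i = sym (trans (cong (λ z → suc z % (3 + k)) (toℕ-inject₁ i)) (m<n⇒m%n≡m (s≤s (toℕ<n i))))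

  arc-predecessor : ∀ j → ∃ λ i → Arc i j
  arc-predecessor (suc i) = inject₁ i , arc-inject₁ i
  arc-predecessor zero    = fromℕ (2 + k) ,
    sym (trans (cong (λ z → suc z % (3 + k)) (toℕ-fromℕ (2 + k))) (n%n≡0 (3 + k)))

-- The outer cycle and chains modulo it.

module OuterCycle (G : PlaneGraph) (isCycle : IsSimpleCycle (PlaneGraph.outerSubgraph G)) where
  open PlaneGraph G
  open Homology G
  open ≡-Reasoning

  -- As the outer subgraph is induced, these are exactly the darts of the outer cycle; every other
  -- dart has an internal end.
  Ext : Dart → Set
  Ext d = External (origin d) × External (origin (rev d))

  ext? : ∀ d → Dec (Ext d)
  ext? d = external? (origin d) ×-dec external? (origin (rev d))

  ext-rev : ∀ d → Ext d → Ext (rev d)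
  ext-rev d (p , q) = q , subst (External ∘ origin) (sym (rev-involutive d)) p

  -- The head of `d` touches the same face: it fills the sector just before `rev d` in the rotation
  -- there.
  outer⇒Ext : ∀ d → face d ≡ outerFace → Ext d
  outer⇒Ext d fd with e , eq ← next-surjective (rev d) =
    inj₁ (d , refl , fd) ,
    inj₁ (e , trans (sym (next-origin e)) (cong origin eq) , (begin
      face e              ≡⟨ face-sector e ⟨
      face (rev (next e)) ≡⟨ cong (face ∘ rev) eq ⟩
      face (rev (rev d))  ≡⟨ cong face (rev-involutive d) ⟩
      face d              ≡⟨ fd ⟩
      outerFace           ∎))

  outerʳ⇒Ext : ∀ d → face (rev d) ≡ outerFace → Ext d
  outerʳ⇒Ext d fd = subst Ext (rev-involutive d) (ext-rev (rev d) (outer⇒Ext (rev d) fd))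

  private
    k          = proj₁ isCycle
    c          = proj₁ (proj₂ isCycle)
    c-external = proj₁ (proj₂ (proj₂ (proj₂ isCycle)))
    c-adjacent = proj₂ (proj₂ (proj₂ (proj₂ isCycle)))

  open Arcs k
  open Graph outerSubgraph using (Adj)

  external⇒c : ∀ {v} → External v → ∃ λ i → c i ≡ v
  external⇒c {v} ev = Equivalence.to (c-external v) (_ , ev)

  -- The two neighbours on the cycle determine the two darts, since the graph has no parallel edges.
  two-ext-darts : ∀ {v} → External v → ∃₂ λ a b →
    a ≢ b × origin a ≡ v × origin b ≡ v × (∀ d → origin d ≡ v → Ext d → d ≡ a ⊎ d ≡ b)
  two-ext-darts ev with i , refl ← external⇒c ev
    with i⁺ , arc⁺ ← arc-successor i | i⁻ , arc⁻ ← arc-predecessor i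
    with (a , oa , ta) , _ ← Equivalence.from (c-adjacent i i⁺) (inj₁ arc⁺)
       | (b , ob , tb) , _ ← Equivalence.from (c-adjacent i i⁻) (inj₂ arc⁻) =
    a , b , a≢b , oa , ob , only
    where
    a≢b : a ≢ b
    a≢b refl = arc-asymmetric {i} {i⁺} arc⁺ (subst (λ j → Arc j i) (sym i⁺≡i⁻) arc⁻)
      where
      i⁺≡i⁻ : i⁺ ≡ i⁻
      i⁺≡i⁻ = proj₁ (proj₂ (proj₂ isCycle)) (trans (sym ta) tb)
    only : ∀ d → origin d ≡ c i → Ext d → d ≡ a ⊎ d ≡ b
    only d od (ed , ed′) with j , cj ← external⇒c ed′
      with Equivalence.to (c-adjacent i j) ((d , od , sym cj) , subst External od ed , subst External (sym cj) ed′)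
    ... | inj₁ arc = inj₁ (no-parallel d a (trans od (sym oa))
                      (trans (sym cj) (trans (cong c (arc-functional {i} arc arc⁺)) (sym ta))))
    ... | inj₂ arc = inj₂ (no-parallel d b (trans od (sym ob))
                      (trans (sym cj) (trans (cong c (arc-injective {j} {i⁻} {i} arc arc⁻)) (sym tb))))

  -- The two cycle darts at `v` are consecutive in the rotation, with the outer face between them.
  record OuterSector (v : Vertex) : Set where
    field
      dart      : Dart
      at        : origin dart ≡ v
      outer     : face dart ≡ outerFace
      next-≢    : next dart ≢ dart
      only      : ∀ d → origin d ≡ v → Ext d → d ≡ dart ⊎ d ≡ next dart

    ext : Ext dart
    ext = outer⇒Ext dart outer

    ext-next : Ext (next dart)
    ext-next = outerʳ⇒Ext (next dart) (trans (face-sector dart) outer)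

    at-next : origin (next dart) ≡ v
    at-next = trans (next-origin dart) at

  -- Both darts bounding a sector of the outer face are in `Ext`. They differ, because a dart fixed
  -- by `next` would be the only one at `v`; so they are the two cycle darts.
  outerSector : ∀ {v} → External v → OuterSector v
  outerSector ev with two-ext-darts ev
  outerSector (inj₂ (isolated , _))      | a , _ , _ , oa , _ = contradiction oa (isolated a)
  outerSector {v} (inj₁ (d₀ , od₀ , fd₀)) | a , b , a≢b , oa , ob , only-ab = record
    { dart = d₀ ; at = od₀ ; outer = fd₀ ; next-≢ = next-≢ ; only = only }
    where
    fixed : next d₀ ≡ d₀ → ∀ j → fold d₀ next j ≡ d₀
    fixed eq zero    = refl
    fixed eq (suc j) = trans (cong next (fixed eq j)) eq
    all-d₀ : next d₀ ≡ d₀ → ∀ d → origin d ≡ v → d₀ ≡ d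
    all-d₀ eq d od with j , p ← next-cyclic d₀ d (trans od₀ (sym od)) = trans (sym (fixed eq j)) p
    next-≢ : next d₀ ≢ d₀
    next-≢ eq = a≢b (trans (sym (all-d₀ eq a oa)) (all-d₀ eq b ob))
    only : ∀ d → origin d ≡ v → Ext d → d ≡ d₀ ⊎ d ≡ next d₀
    only d od ed with only-ab d od ed
                    | only-ab d₀ od₀ (outer⇒Ext d₀ fd₀)
                    | only-ab (next d₀) (trans (next-origin d₀) od₀) (outerʳ⇒Ext (next d₀) (trans (face-sector d₀) fd₀))
    ... | inj₁ p | inj₁ q | _      = inj₁ (trans p (sym q))
    ... | inj₂ p | inj₂ q | _      = inj₁ (trans p (sym q))
    ... | inj₁ p | inj₂ _ | inj₁ r = inj₂ (trans p (sym r))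
    ... | inj₂ p | inj₁ _ | inj₂ r = inj₂ (trans p (sym r))
    ... | inj₁ _ | inj₂ q | inj₂ r = contradiction (trans r (sym q)) next-≢
    ... | inj₂ _ | inj₁ q | inj₁ r = contradiction (trans r (sym q)) next-≢

  ∂-ext-supported : ∀ y → (∀ d → ¬ Ext d → y d ≡ false) → ∀ {v} (s : OuterSector v) →
                    let open OuterSector s in ∂ y v ≡ y dart xor y (next dart)
  ∂-ext-supported y y≡0 {v} s = begin
    ∂ y v
      ≡⟨ ∂-cong v expand ⟩
    ∂ (λ d → (y dart ∧ does (d ≟ᵈ dart)) xor (y (next dart) ∧ does (d ≟ᵈ next dart))) v
      ≡⟨ ∂-xor (λ d → y dart ∧ does (d ≟ᵈ dart)) _ v ⟩
    ∂ (λ d → y dart ∧ does (d ≟ᵈ dart)) v xor ∂ (λ d → y (next dart) ∧ does (d ≟ᵈ next dart)) v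
      ≡⟨ cong₂ _xor_ (point dart at) (point (next dart) at-next) ⟩
    y dart xor y (next dart) ∎
    where
    open OuterSector s
    point : ∀ e → origin e ≡ v → ∂ (λ d → y e ∧ does (d ≟ᵈ e)) v ≡ y e
    point e oe = trans (∂-∧ (y e) _ v)
      (trans (cong (y e ∧_) (trans (∂-point e v) (dec-true (origin e ≟ v) oe))) (∧-identityʳ _))
    expand : ∀ d → origin d ≡ v → y d ≡ (y dart ∧ does (d ≟ᵈ dart)) xor (y (next dart) ∧ does (d ≟ᵈ next dart))
    expand d od with d ≟ᵈ dart | d ≟ᵈ next dart
    ... | yes refl | yes eq   = contradiction (sym eq) next-≢
    ... | yes refl | no _     = sym (trans (cong₂ _xor_ (∧-identityʳ (y d)) (∧-zeroʳ (y (next d)))) (xor-identityʳ _))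
    ... | no _     | yes refl = sym (trans (cong (_xor (y d ∧ true)) (∧-zeroʳ (y dart))) (∧-identityʳ (y d)))
    ... | no d≢    | no d≢′   = trans (y≡0 d λ ed → [ d≢ , d≢′ ]′ (only d od ed))
      (sym (cong₂ _xor_ (∧-zeroʳ (y dart)) (∧-zeroʳ (y (next dart)))))

  outer-connected : ∀ {u v} → External u → External v → Star Adj u v
  outer-connected eu ev with i , refl ← external⇒c eu | j , refl ← external⇒c ev =
    toBase i ◅◅ reverse (Graph.Adj-sym outerSubgraph) (toBase j)
    where
    toBase : ∀ i → Star Adj (c i) (c zero)
    toBase = <-weakInduction _ ε λ i p → Equivalence.from (c-adjacent (suc i) (inject₁ i)) (inj₂ (arc-inject₁ i)) ◅ p

  outerWalk : ∀ {u v} → Star Adj u v → Edge → Bool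
  outerWalk p = walk (Star.map proj₁ p)

  outerWalk-ext : ∀ {u v} (p : Star Adj u v) d → ¬ Ext d → outerWalk p (proj₁ d) ≡ false
  outerWalk-ext ε d _ = refl
  outerWalk-ext (((s , refl , refl) , es) ◅ p) d ¬ed =
    cong₂ _xor_ (dec-false (proj₁ d ≟ proj₁ s) ≢s) (outerWalk-ext p d ¬ed)
    where
    ≢s : proj₁ d ≢ proj₁ s
    ≢s eq with same-edge d s eq
    ... | inj₁ refl = ¬ed es
    ... | inj₂ refl = ¬ed (ext-rev s es)

  base : Vertex
  base = c zero

  base-external : External base
  base-external = proj₂ (Equivalence.from (c-external base) (zero , refl))

  open OuterSector (outerSector base-external) public using ()
    renaming (dart to outerDart; outer to outerDart-outer; ext to outerDart-ext)

  -- That it differs from `outerFace` follows from `outerFlip`.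
  innerFace : Face
  innerFace = face (rev outerDart)

  -- A vanishing boundary at an external vertex makes the values on its two cycle darts agree, and
  -- this propagates along the cycle.
  closed-on-cycle⇒constant : ∀ y → (∀ d → y (rev d) ≡ y d) → (∀ v → ∂ y v ≡ false) →
    (∀ d → ¬ Ext d → y d ≡ false) → ∀ {d e} → Ext d → Ext e → y d ≡ y e
  closed-on-cycle⇒constant y sy closed y≡0 {d} {e} ed ee = along (outer-connected (proj₁ ed) (proj₁ ee)) d refl ed
    where
    same-origin : ∀ d e → origin d ≡ origin e → Ext d → Ext e → y d ≡ y e
    same-origin d e oe ed ee with only d refl ed | only e (sym oe) ee
      where open OuterSector (outerSector (proj₁ ed))
    ... | inj₁ p | inj₁ q = cong y (trans p (sym q))
    ... | inj₂ p | inj₂ q = cong y (trans p (sym q))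
    ... | inj₁ p | inj₂ q = trans (cong y p) (trans swap (cong y (sym q)))
      where swap = xor≡false⇒≡ (trans (sym (∂-ext-supported y y≡0 (outerSector (proj₁ ed)))) (closed _))
    ... | inj₂ p | inj₁ q = trans (cong y p) (trans (sym swap) (cong y (sym q)))
      where swap = xor≡false⇒≡ (trans (sym (∂-ext-supported y y≡0 (outerSector (proj₁ ed)))) (closed _))
    along : ∀ {u} → Star Adj u (origin e) → ∀ d → origin d ≡ u → Ext d → y d ≡ y e
    along ε d od ed = same-origin d e od ed ee
    along (((s , refl , refl) , es) ◅ p) d od ed =
      trans (same-origin d s od ed es) (trans (sym (sy s)) (along p (rev s) refl (ext-rev s es)))

  -- The jump of `x` is constant along the outer cycle, and the two prescribed values make it zero
  -- at `outerDart`. This bounds the kernel by one bit.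
  outer-δ≡0⇒≡0 : ∀ x → (∀ d → ¬ Ext d → δ x d ≡ false) → x outerFace ≡ false → x innerFace ≡ false →
                 ∀ f → x f ≡ false
  outer-δ≡0⇒≡0 x δ≡0 xo xi f = trans (δ≡0⇒constant {x} all≡0 f outerFace) xo
    where
    all≡0 : ∀ d → δ x d ≡ false
    all≡0 d with ext? d
    ... | no ¬ed = δ≡0 d ¬ed
    ... | yes ed = trans (closed-on-cycle⇒constant (δ x) (δ-rev x) (∂δ x) δ≡0 ed outerDart-ext)
                         (cong₂ _xor_ (trans (cong x outerDart-outer) xo) xi)

  -- `χ` is the interior of the outer cycle, obtained by exactness from the closed indicator of that
  -- cycle. Adding it exchanges the two solutions.
  outerFlip : ∃ λ χ → χ outerFace ≡ false × χ innerFace ≡ true × (∀ d → ¬ Ext d → δ χ d ≡ false)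
  outerFlip = let χ , χo , δχ = closed⇒exact (does ∘ ext?) symmetric closed in
    χ , χo ,
    trans (cong (_xor χ innerFace) (sym (trans (cong χ outerDart-outer) χo)))
          (trans (δχ outerDart) (dec-true (ext? outerDart) outerDart-ext)) ,
    λ d ¬ed → trans (δχ d) (dec-false (ext? d) ¬ed)
    where
    symmetric : ∀ d → does (ext? (rev d)) ≡ does (ext? d)
    symmetric d = does-⇔ (mk⇔ (λ e → subst Ext (rev-involutive d) (ext-rev (rev d) e)) (ext-rev d))
                    (ext? (rev d)) (ext? d)
    closed : ∀ v → ∂ (does ∘ ext?) v ≡ false
    closed v with external? v
    ... | no ¬ev = ∂-zero v λ { d refl → dec-false (ext? d) (¬ev ∘ proj₁) }
    ... | yes ev = trans (∂-ext-supported _ (λ d → dec-false (ext? d)) (outerSector ev))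
                         (cong₂ _xor_ (dec-true (ext? dart) ext) (dec-true (ext? (next dart)) ext-next))
      where open OuterSector (outerSector ev)

  -- The correction on the outer cycle joins the external vertices of odd boundary to a base
  -- point; nothing is left over there, because a boundary has an even number of odd vertices.
  closed-inside⇒exact : ∀ y → (∀ d → y (rev d) ≡ y d) → (∀ v → Internal v → ∂ y v ≡ false) →
    ∃ λ x → x outerFace ≡ false × (∀ d → ¬ Ext d → δ x d ≡ y d)
  closed-inside⇒exact y sy closed =
    let x , xo , δx = closed⇒exact (λ d → y d xor correction (proj₁ d))
                        (λ d → cong (_xor correction (proj₁ d)) (sy d)) closed′
    in x , xo , λ d ¬ed → trans (δx d) (trans (cong (y d xor_) (correction-ext d ¬ed)) (xor-identityʳ _))
    where
    toBase : Vertex → Edge → Bool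
    toBase v with external? v
    ... | yes ev = outerWalk (outer-connected ev base-external)
    -- `∂ y` vanishes at internal vertices, so this chain is never selected; the value zero keeps
    -- `toBase-ext` valid there.
    ... | no _   = λ _ → false
    ∂-toBase : ∀ v → ∂ y v ≡ true → ∀ w → ∂ (toBase v ∘ proj₁) w ≡ does (v ≟ w) xor does (base ≟ w)
    ∂-toBase v odd-v w with external? v
    ... | yes ev = ∂-walk (Star.map proj₁ (outer-connected ev base-external)) w
    ... | no  iv = contradiction (trans (sym odd-v) (closed v iv)) λ ()
    toBase-ext : ∀ v d → ¬ Ext d → toBase v (proj₁ d) ≡ false
    toBase-ext v d ¬ed with external? v
    ... | yes ev = outerWalk-ext (outer-connected ev base-external) d ¬ed
    ... | no  _  = refl
    correction : Edge → Bool
    correction = combine toBase (∂ y)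
    correction-ext : ∀ d → ¬ Ext d → correction (proj₁ d) ≡ false
    correction-ext d ¬ed = trans (⨁-cong (allFin nV) (λ v → trans (cong (∂ y v ∧_) (toBase-ext v d ¬ed)) (∧-zeroʳ _)))
                                 (⨁-zero (allFin nV))
    closed′ : ∀ w → ∂ (λ d → y d xor correction (proj₁ d)) w ≡ false
    closed′ w = begin
      ∂ (λ d → y d xor correction (proj₁ d)) w ≡⟨ ∂-xor y _ w ⟩
      ∂ y w xor ∂ (correction ∘ proj₁) w
        ≡⟨ cong (∂ y w xor_) (∂-combine toBase (λ _ → base) (∂ y) ∂-toBase w) ⟩
      ∂ y w xor (∂ y w xor _)                  ≡⟨ cong (λ z → ∂ y w xor (∂ y w xor z)) leftover ⟩
      ∂ y w xor (∂ y w xor false)              ≡⟨ cong (∂ y w xor_) (xor-identityʳ (∂ y w)) ⟩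
      ∂ y w xor ∂ y w                          ≡⟨ xor-same (∂ y w) ⟩
      false                                    ∎
      where
      leftover : ⨁ (allFin nV) (λ v → ∂ y v ∧ does (base ≟ w)) ≡ false
      leftover = trans (⨁-cong (allFin nV) (λ v → ∧-comm (∂ y v) _))
        (trans (⨁-∧ˡ (allFin nV) (does (base ≟ w)) (∂ y)) (trans (cong (does (base ≟ w) ∧_) (⨁-∂ sy)) (∧-zeroʳ _)))

  -- In the rotation from the outer sector, `next dart` leads into the inner sectors and only `dart`
  -- leads back; at all darts in between `x` does not change. The invariant of `go` keeps the outer
  -- face as an alternative because `j` may run through several turns.
  inner-sectors-constant : ∀ x {b} (s : OuterSector b) → (∀ d → origin d ≡ b → ¬ Ext d → δ x d ≡ false) →
    let open OuterSector s in
    ∀ d → origin d ≡ b → face d ≢ outerFace → x (face d) ≡ x (face (next dart))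
  inner-sectors-constant x {b} s δ≡0 d od fd≢
    with j , refl ← next-cyclic (OuterSector.dart s) d (trans (OuterSector.at s) (sym od)) =
    [ (λ eq → contradiction eq fd≢) , id ]′ (go j)
    where
    open OuterSector s
    go : ∀ j → face (fold dart next j) ≡ outerFace ⊎ x (face (fold dart next j)) ≡ x (face (next dart))
    go zero    = inj₁ outer
    go (suc j) with ext? (next (fold dart next j))
    ... | yes ed with only _ (trans (origin-fold dart (suc j)) at) ed
    ...   | inj₁ eq = inj₁ (trans (cong face eq) outer)
    ...   | inj₂ eq = inj₂ (cong (x ∘ face) eq)
    go (suc j) | no ¬ed with go j
    ...   | inj₁ eq = contradiction (outerʳ⇒Ext _ (trans (face-sector _) eq)) ¬ed
    ...   | inj₂ eq = inj₂ (trans (xor≡false⇒≡ (δ≡0 _ (trans (origin-fold dart (suc j)) at) ¬ed))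
                                  (trans (cong x (face-sector _)) eq))

-- Degrees and orbits of the rotation.

module Degrees (G : PlaneGraph) where
  open PlaneGraph G
  open Homology G
  open Graph graph using (degree; Adj?)
  open ≡-Reasoning

  -- At most one dart runs from `v` to `u`, so counting such darts mod 2 loses nothing.
  does-adj : ∀ v u → does (Adj? v u) ≡ ∂ (λ d → does (origin (rev d) ≟ u)) v
  does-adj v u = count (Adj? v u)
    where
    count : Dec (Adjacent v u) → does (Adj? v u) ≡ ∂ (λ d → does (origin (rev d) ≟ u)) v
    count (no ¬adj) = trans (dec-false (Adj? v u) ¬adj)
      (sym (∂-zero v λ d od → dec-false (origin (rev d) ≟ u) (λ td → ¬adj (d , od , td))))
    count (yes adj@(d , od , td)) = trans (dec-true (Adj? v u) adj) (sym (trans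
      (⨁ᵈ-single d not-both)
      (cong₂ _∧_ (dec-true (origin d ≟ v) od) (dec-true (origin (rev d) ≟ u) td))))
      where
      not-both : ∀ e → e ≢ d → does (origin e ≟ v) ∧ does (origin (rev e) ≟ u) ≡ false
      not-both e e≢d with origin e ≟ v | origin (rev e) ≟ u
      ... | yes oe | yes te = contradiction (no-parallel e d (trans oe (sym od)) (trans te (sym td))) e≢d
      ... | yes _  | no  _  = refl
      ... | no  _  | _      = refl

  -- Translates counts of neighbours into boundaries; the parities of `degree` and of `degreeInto`
  -- are both instances.
  ⨁-adj : ∀ (w : Vertex → Bool) v → ⨁ (allFin nV) (λ u → w u ∧ does (Adj? v u)) ≡ ∂ (w ∘ origin ∘ rev) v
  ⨁-adj w v = begin
    ⨁ (allFin nV) (λ u → w u ∧ does (Adj? v u))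
      ≡⟨ ⨁-cong (allFin nV) (λ u → trans (cong (w u ∧_) (does-adj v u)) (sym (∂-∧ (w u) _ v))) ⟩
    ⨁ (allFin nV) (λ u → ∂ (λ d → w u ∧ does (origin (rev d) ≟ u)) v)
      ≡⟨ ∂-⨁ (allFin nV) (λ u d → w u ∧ does (origin (rev d) ≟ u)) v ⟨
    ∂ (λ d → ⨁ (allFin nV) (λ u → w u ∧ does (origin (rev d) ≟ u))) v
      ≡⟨ ∂-cong v (λ d _ → tip d) ⟩
    ∂ (w ∘ origin ∘ rev) v ∎
    where
    tip : ∀ d → ⨁ (allFin nV) (λ u → w u ∧ does (origin (rev d) ≟ u)) ≡ w (origin (rev d))
    tip d = trans
      (⨁ᶠ-single (origin (rev d)) (λ u ne → trans (cong (w u ∧_) (dec-false (origin (rev d) ≟ u) (ne ∘ sym))) (∧-zeroʳ _)))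
      (trans (cong (w (origin (rev d)) ∧_) (dec-true (origin (rev d) ≟ origin (rev d)) refl)) (∧-identityʳ _))

  odd-degree : ∀ v → odd (degree v) ≡ ∂ (λ _ → true) v
  odd-degree v = trans (odd-∣tabulate∣ nV _) (⨁-adj (λ _ → true) v)

  odd-degreeInto-inner : ∀ C → (∀ v → v ∈ C → Internal v) → ∀ {v} → Internal v →
    odd (Graph.degreeInto innerSubgraph C v) ≡ ∂ (lookup C ∘ origin ∘ rev) v
  odd-degreeInto-inner C C⊆I {v} iv =
    trans (odd-∣tabulate∣ nV _) (trans (⨁-cong (allFin nV) term) (⨁-adj (lookup C) v))
    where
    term : ∀ u → does (u ∈? C) ∧ (does (Adj? v u) ∧ (does (internal? v) ∧ does (internal? u))) ≡
                 lookup C u ∧ does (Adj? v u)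
    term u with u ∈? C
    ... | no u∉C  = cong (_∧ does (Adj? v u)) (sym (∉⇒≡false u∉C))
    ... | yes u∈C = begin
      does (Adj? v u) ∧ (does (internal? v) ∧ does (internal? u))
        ≡⟨ cong₂ (λ a b → does (Adj? v u) ∧ (a ∧ b)) (dec-true (internal? v) iv) (dec-true (internal? u) (C⊆I u u∈C)) ⟩
      does (Adj? v u) ∧ true
        ≡⟨ ∧-identityʳ _ ⟩
      does (Adj? v u)
        ≡⟨ cong (_∧ does (Adj? v u)) (∈⇒≡true u∈C) ⟨
      lookup C u ∧ does (Adj? v u) ∎

  period-shift : ∀ d e p → origin e ≡ origin d → fold e next p ≡ e → fold d next p ≡ d
  period-shift d e p oe eq with l , refl ← next-cyclic e d oe = begin
    fold (fold e next l) next p ≡⟨ fold-+ e p l ⟨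
    fold e next (p + l)         ≡⟨ cong (fold e next) (ℕ.+-comm p l) ⟩
    fold e next (l + p)         ≡⟨ fold-+ e l p ⟩
    fold (fold e next p) next l ≡⟨ cong (λ z → fold z next l) eq ⟩
    fold e next l               ∎

  -- Without such a period the first 1 + degree successors of d would be distinct, and so
  -- would be their tips.
  period≤degree : ∀ d → ∃ λ p → p < degree (origin d) × fold d next (suc p) ≡ d
  period≤degree d with any? {n = degree (origin d)} (λ p → fold d next (suc (toℕ p)) ≟ᵈ d)
  ... | yes (p , eq) = toℕ p , toℕ<n p , eq
  ... | no  none     = contradiction
    (injection⇒≤∣p∣ (suc (degree (origin d))) _ tip tip-injective tip∈) (ℕ.<-irrefl refl)
    where
    tip : Fin (suc (degree (origin d))) → Vertex
    tip i = origin (rev (fold d next (toℕ i)))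
    tip∈ : ∀ i → tip i ∈ tabulate (λ u → does (Adj? (origin d) u))
    tip∈ i = ≡true⇒∈ (trans (lookup∘tabulate _ (tip i))
      (dec-true (Adj? (origin d) (tip i)) (fold d next (toℕ i) , origin-fold d (toℕ i) , refl)))
    distinct : ∀ i j → i < j → j ≤ degree (origin d) → fold d next i ≢ fold d next j
    distinct i j i<j j≤ eq with q , refl ← ℕ.m≤n⇒∃[o]m+o≡n i<j =
      none (fromℕ< q< , subst (λ z → fold d next (suc z) ≡ d) (sym (toℕ-fromℕ< q<))
        (period-shift d (fold d next i) (suc q) (origin-fold d i)
          (sym (trans eq (trans (cong (fold d next) (ℕ.+-comm (suc i) q))
            (trans (cong (fold d next) (ℕ.+-suc q i)) (fold-+ d (suc q) i)))))))
      where
      q< : q < degree (origin d)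
      q< = ℕ.≤-trans (s≤s (ℕ.m≤n+m q i)) j≤
    tip-injective : ∀ {i j} → tip i ≡ tip j → i ≡ j
    tip-injective {i} {j} eq with ℕ.<-cmp (toℕ i) (toℕ j)
      | no-parallel _ _ (trans (origin-fold d (toℕ i)) (sym (origin-fold d (toℕ j)))) eq
    ... | tri< i<j _ _ | same = contradiction same (distinct _ _ i<j (ℕ.≤-pred (toℕ<n j)))
    ... | tri≈ _ e _   | _    = toℕ-injective e
    ... | tri> _ _ j<i | same = contradiction (sym same) (distinct _ _ j<i (ℕ.≤-pred (toℕ<n i)))

  -- `AlternateSectors` speaks only of indices below the degree. Together with `period≤degree` this
  -- reaches every dart at the vertex within that range.
  orbit-bounded : ∀ d e p → origin d ≡ origin e → fold d next (suc p) ≡ d → ∃ λ r → r ≤ p × fold d next r ≡ e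
  orbit-bounded d e p oe eq with l , refl ← next-cyclic d e oe =
    l % suc p , ℕ.≤-pred (m%n<n l (suc p)) , sym (begin
      fold d next l
        ≡⟨ cong (fold d next) (m≡m%n+[m/n]*n l (suc p)) ⟩
      fold d next (l % suc p + (l / suc p) * suc p)              ≡⟨ fold-+ d (l % suc p) _ ⟩
      fold (fold d next ((l / suc p) * suc p)) next (l % suc p)
        ≡⟨ cong (λ z → fold z next (l % suc p)) (fold-* d (suc p) (l / suc p) eq) ⟩
      fold d next (l % suc p)                                    ∎)

  previous-sector : ∀ d → ∃ λ e → origin e ≡ origin d × face e ≡ face (rev d)
  previous-sector d with e , refl ← next-surjective d = e , sym (next-origin e) , sym (face-sector e)

-- The correspondence between nests and channels.

module Nests (G : BipartitePlaneGraph) (semiEulerian : InnerSemiEulerian G)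
             (noIsolated : NoIsolatedInternalBlack G)
             (isCycle : IsSimpleCycle (BipartitePlaneGraph.outerSubgraph G)) where
  open BipartitePlaneGraph G
  open Homology planeGraph
  open Degrees planeGraph
  open OuterCycle planeGraph isCycle
  open Graph graph using (degree)
  open Graph innerSubgraph using (degreeInto)
  open ≡-Reasoning

  BlackInternal : Subset nV → Set
  BlackInternal C = ∀ v → v ∈ C → Internal v × colour v ≡ black

  coboundary : Subset nV → Dart → Bool
  coboundary C d = lookup C (origin d) xor lookup C (origin (rev d))

  -- Nothing is asked on the outer cycle, where `S` may jump although both ends are external.
  Compatible : Subset nF → Subset nV → Set
  Compatible S C = ∀ d → ¬ Ext d → δ (lookup S) d ≡ coboundary C d

  coboundary-rev : ∀ C d → coboundary C (rev d) ≡ coboundary C d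
  coboundary-rev C d = trans (cong (λ e → lookup C (origin (rev d)) xor lookup C (origin e)) (rev-involutive d))
                             (xor-comm (lookup C (origin (rev d))) _)

  -- A vertex of `C` contributes its own degree, which is even since the vertex is internal and
  -- black; only its neighbours in `C` remain.
  ∂-coboundary : ∀ {C} → BlackInternal C → ∀ {v} → Internal v → ∂ (coboundary C) v ≡ odd (degreeInto C v)
  ∂-coboundary {C} bi {v} iv = begin
    ∂ (coboundary C) v                                          ≡⟨ ∂-xor _ _ v ⟩
    ∂ (lookup C ∘ origin) v xor ∂ (lookup C ∘ origin ∘ rev) v
      ≡⟨ cong₂ _xor_ own (sym (odd-degreeInto-inner C (λ u → proj₁ ∘ bi u) iv)) ⟩
    odd (degreeInto C v)                                        ∎
    where
    own : ∂ (lookup C ∘ origin) v ≡ false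
    own with v ∈? C
    ... | no v∉C  = ∂-zero v λ { _ refl → ∉⇒≡false v∉C }
    ... | yes v∈C = begin
      ∂ (lookup C ∘ origin) v ≡⟨ ∂-cong v (λ { _ refl → ∈⇒≡true v∈C }) ⟩
      ∂ (λ _ → true) v        ≡⟨ odd-degree v ⟨
      odd (degree v)          ≡⟨ 2∣⇒even (semiEulerian v iv (proj₂ (bi v v∈C))) ⟩
      false                   ∎

  compatible⇒channel : ∀ {S C} → BlackInternal C → Compatible S C → IsBlackChannel innerSubgraph colour C
  compatible⇒channel {S} {C} bi compat =
    ((λ v v∈C → _ , proj₁ (bi v v∈C)) , λ v (_ , iv) → even⇒2∣ _ (begin
      odd (degreeInto C v) ≡⟨ ∂-coboundary bi iv ⟨
      ∂ (coboundary C) v   ≡⟨ ∂-cong v (λ { d refl → compat d (λ ed → iv (proj₁ ed)) }) ⟨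
      ∂ (δ (lookup S)) v   ≡⟨ ∂δ (lookup S) v ⟩
      false                ∎)) , λ v v∈C → proj₂ (bi v v∈C)

  channel⇒blackInternal : ∀ {C} → IsBlackChannel innerSubgraph colour C → BlackInternal C
  channel⇒blackInternal ((vert , _) , blk) v v∈C = proj₂ (vert v v∈C) , blk v v∈C

  abstract
    -- If the solution has the wrong bit at `innerFace`, adding the flip corrects it without
    -- touching the jumps off the outer cycle.
    realise : ∀ {C} → IsBlackChannel innerSubgraph colour C → ∀ β →
              ∃ λ S → outerFace ∉ S × Compatible S C × lookup S innerFace ≡ β
    realise {C} ch@((_ , even) , _) β = choose
      (closed-inside⇒exact (coboundary C) (coboundary-rev C)
        λ v iv → trans (∂-coboundary (channel⇒blackInternal ch) iv) (2∣⇒even (even v (_ , iv))))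
      outerFlip
      where
      Solution : (Face → Bool) → Set
      Solution x = x outerFace ≡ false × (∀ d → ¬ Ext d → δ x d ≡ coboundary C d)
      package : ∀ x → Solution x → x innerFace ≡ β →
                ∃ λ S → outerFace ∉ S × Compatible S C × lookup S innerFace ≡ β
      package x (xo , δx) xi = tabulate x , ≡false⇒∉ (trans (lookup∘tabulate x _) xo) ,
        (λ d ¬ed → trans (cong₂ _xor_ (lookup∘tabulate x _) (lookup∘tabulate x _)) (δx d ¬ed)) ,
        trans (lookup∘tabulate x _) xi
      choose : ∃ Solution → (∃ λ χ → χ outerFace ≡ false × χ innerFace ≡ true × (∀ d → ¬ Ext d → δ χ d ≡ false)) →
               ∃ λ S → outerFace ∉ S × Compatible S C × lookup S innerFace ≡ β
      choose (x , xo , δx) (χ , χo , χi , δχ) with x innerFace 𝔹.≟ β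
      ... | yes xi = package x (xo , δx) xi
      ... | no  xi = package (λ f → χ f xor x f)
        (cong₂ _xor_ χo xo , λ d ¬ed → trans (δ-xor χ x d) (cong₂ _xor_ (δχ d ¬ed) (δx d ¬ed)))
        (trans (cong (_xor x innerFace) χi) (sym (𝔹.¬-not (xi ∘ sym))))

  alternating? : ∀ S v → Dec (Internal v × colour v ≡ black × (∀ d → origin d ≡ v → δ (lookup S) d ≡ true))
  alternating? S v = internal? v ×-dec black? (colour v) ×-dec
                     everyDart? (λ d → (origin d ≟ v) →-dec (δ (lookup S) d 𝔹.≟ true))

  alternating : Subset nF → Subset nV
  alternating S = tabulate (does ∘ alternating? S)

  alternating⁺ : ∀ {S v} → Internal v → colour v ≡ black → (∀ d → origin d ≡ v → δ (lookup S) d ≡ true) →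
                 v ∈ alternating S
  alternating⁺ {S} {v} iv bv all = ≡true⇒∈ (trans (lookup∘tabulate _ v) (dec-true (alternating? S v) (iv , bv , all)))

  alternating⁻ : ∀ {S v} → v ∈ alternating S →
                 Internal v × colour v ≡ black × (∀ d → origin d ≡ v → δ (lookup S) d ≡ true)
  alternating⁻ {S} {v} v∈ = does⇒ (alternating? S v) (trans (sym (lookup∘tabulate _ v)) (∈⇒≡true v∈))

  alternating-blackInternal : ∀ S → BlackInternal (alternating S)
  alternating-blackInternal S v v∈ = let iv , bv , _ = alternating⁻ {S} v∈ in iv , bv

  neighbour∉ : ∀ {C} → BlackInternal C → ∀ d → colour (origin d) ≡ black → lookup C (origin (rev d)) ≡ false
  neighbour∉ bi d bd = ∉⇒≡false λ r∈C → proper d (trans bd (sym (proj₂ (bi _ r∈C))))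

  coboundary-black : ∀ {C} → BlackInternal C → ∀ d → colour (origin d) ≡ black → coboundary C d ≡ lookup C (origin d)
  coboundary-black {C} bi d bd = trans (cong (lookup C (origin d) xor_) (neighbour∉ {C} bi d bd)) (xor-identityʳ _)

  -- At a vertex without darts the condition in `alternating?` would hold vacuously, whatever `C`
  -- says.
  dartAt : ∀ {v} → Internal v → colour v ≡ black → ∃ λ d → origin d ≡ v
  dartAt {v} iv bv with someDart? (λ d → origin d ≟ v)
  ... | yes p = p
  ... | no ¬p = contradiction (λ d od → ¬p (d , od)) (noIsolated v iv bv)

  alternating-unique : ∀ {S C} → BlackInternal C → Compatible S C → alternating S ≡ C
  alternating-unique {S} {C} bi compat = lookup-ext λ v → bool-ext
    (λ e → let iv , bv , all = alternating⁻ {S} (≡true⇒∈ e) ; d , od = dartAt iv bv in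
           trans (sym (crossing bv d od iv)) (all d od))
    (λ e → let iv , bv = bi v (≡true⇒∈ e) in
           ∈⇒≡true (alternating⁺ {S} iv bv (λ d od → trans (crossing bv d od iv) e)))
    where
    crossing : ∀ {v} → colour v ≡ black → ∀ d → origin d ≡ v → Internal v → δ (lookup S) d ≡ lookup C v
    crossing bv d refl iv = trans (compat d (iv ∘ proj₁)) (coboundary-black {C} bi d bv)

  -- The sectors on the two sides of a dart have consecutive indices `r` and `r + 1`, hence opposite
  -- parity, except possibly where the numbering wraps around.
  alternateSectors⇒ : ∀ {b S} → 2 ∣ degree b → AlternateSectors G b S → ∀ d → origin d ≡ b → δ (lookup S) d ≡ true
  alternateSectors⇒ {S = S} even (s , refl , alt) d od
    with p , p<m , per ← period≤degree s
       | e , refl ← next-surjective d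
    with r , r≤p , refl ← orbit-bounded s e p (trans (sym od) (next-origin e)) per = begin
    δ (lookup S) (next (fold s next r))
      ≡⟨ cong (λ f → lookup S (face (next (fold s next r))) xor lookup S f) (face-sector _) ⟩
    lookup S (face (next (fold s next r))) xor lookup S (face (fold s next r))
      ≡⟨ cong₂ _xor_ successor (parity r r<m) ⟩
    odd r xor not (odd r)                                 ≡⟨ 𝔹.xor-inverseʳ (odd r) ⟩
    true                                                  ∎
    where
    r<m : r < degree (origin s)
    r<m = ℕ.≤-<-trans r≤p p<m
    parity : ∀ i → i < degree (origin s) → lookup S (face (fold s next i)) ≡ not (odd i)
    parity i i<m = ∈⇔2∣⇒parity i (subst (λ z → face (fold s next z) ∈ S ⇔ 2 ∣ z) (toℕ-fromℕ< i<m) (alt (fromℕ< i<m)))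
    successor : lookup S (face (next (fold s next r))) ≡ odd r
    successor with ℕ.m≤n⇒m<n∨m≡n r<m
    ... | inj₁ r+1<m = trans (parity (suc r) r+1<m) (𝔹.not-involutive (odd r))
    -- The wrap-around: the next sector is the starting one, with index 0, and 0 has the parity of
    -- `r + 1` because the degree is even.
    ... | inj₂ r+1≡m = begin
      lookup S (face (fold s next (suc r))) ≡⟨ cong (λ z → lookup S (face (fold s next (suc z)))) r≡p ⟩
      lookup S (face (fold s next (suc p))) ≡⟨ cong (lookup S ∘ face) per ⟩
      lookup S (face s)                     ≡⟨ parity 0 (ℕ.≤-<-trans z≤n r<m) ⟩
      true                                  ≡⟨ cong not (trans (cong odd r+1≡m) (2∣⇒even even)) ⟨
      not (odd (suc r))                     ≡⟨ 𝔹.not-involutive (odd r) ⟩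
      odd r                                 ∎
      where
      r≡p : r ≡ p
      r≡p = ℕ.≤-antisym r≤p (ℕ.≤-pred (subst (suc p ≤_) (sym r+1≡m) p<m))

  ⇒alternateSectors : ∀ {b S} → (∃ λ d → origin d ≡ b) → (∀ d → origin d ≡ b → δ (lookup S) d ≡ true) →
                      AlternateSectors G b S
  ⇒alternateSectors {b} {S} (d , od) all = start (lookup S (face d) 𝔹.≟ true)
    where
    flip : ∀ e → origin e ≡ b → lookup S (face (next e)) ≡ not (lookup S (face e))
    flip e oe = 𝔹.¬-not λ eq → contradiction
      (trans (sym (all (next e) (trans (next-origin e) oe)))
             (trans (cong₂ (λ s f → s xor lookup S f) eq (face-sector e)) (xor-same (lookup S (face e))))) λ ()
    from : ∀ s → origin s ≡ b → lookup S (face s) ≡ true → AlternateSectors G b S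
    from s os s∈ = s , os , λ i → parity⇒∈⇔2∣ (toℕ i) (go (toℕ i))
      where
      go : ∀ i → lookup S (face (fold s next i)) ≡ not (odd i)
      go zero    = s∈
      go (suc i) = trans (flip _ (trans (origin-fold s i) os)) (cong not (go i))
    -- The listing has to begin inside `S`; if the sector of `d` is outside, the following one is
    -- inside.
    start : Dec (lookup S (face d) ≡ true) → AlternateSectors G b S
    start (yes d∈) = from d od d∈
    start (no  d∉) = from (next d) (trans (next-origin d) od) (trans (flip d od) (cong not (𝔹.¬-not d∉)))

  nest⇒δ : ∀ {S} → IsBilliardNest G S → ∀ d → ¬ Ext d → colour (origin d) ≡ black →
           δ (lookup S) d ≡ lookup (alternating S) (origin d)
  nest⇒δ {S} (nest _ internalBlack externalBlack) d ¬ed bd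
    with e , oe , fe ← previous-sector d | external? (origin d)
  ... | yes xd = trans (same (externalBlack _ xd bd)) (sym (∉⇒≡false λ v∈ → proj₁ (alternating⁻ {S} v∈) xd))
    where
    -- The condition at an external vertex covers internal faces only; a dart off the outer cycle
    -- has the outer face on neither side.
    left≢  = ¬ed ∘ outer⇒Ext d
    right≢ = ¬ed ∘ outerʳ⇒Ext d
    right  = inj₁ (e , oe , fe)
    same : AllInternalFaces G (origin d) S ⊎ NoInternalFaces G (origin d) S → δ (lookup S) d ≡ false
    same (inj₁ all)  = cong₂ _xor_ (∈⇒≡true (all _ left≢ (inj₁ (d , refl , refl)))) (∈⇒≡true (all _ right≢ right))
    same (inj₂ none) = cong₂ _xor_ (∉⇒≡false (none _ left≢ (inj₁ (d , refl , refl)))) (∉⇒≡false (none _ right≢ right))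
  ... | no  id = sectors (internalBlack _ id bd)
    where
    equal : δ (lookup S) d ≡ false → δ (lookup S) d ≡ lookup (alternating S) (origin d)
    equal δ≡0 = trans δ≡0 (sym (∉⇒≡false λ v∈ →
      contradiction (trans (sym δ≡0) (proj₂ (proj₂ (alternating⁻ {S} v∈)) d refl)) λ ()))
    sectors : AllSectors G (origin d) S ⊎ NoSectors G (origin d) S ⊎ AlternateSectors G (origin d) S →
              δ (lookup S) d ≡ lookup (alternating S) (origin d)
    sectors (inj₁ all)         = equal (cong₂ _xor_ (∈⇒≡true (all d refl))
                                          (∈⇒≡true (subst (_∈ S) fe (all e oe))))
    sectors (inj₂ (inj₁ none)) = equal (cong₂ _xor_ (∉⇒≡false (none d refl))
                                          (∉⇒≡false (subst (_∉ S) fe (none e oe))))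
    sectors (inj₂ (inj₂ alt))  = let δ≡1 = alternateSectors⇒ {S = S} (semiEulerian _ id bd) alt in
      trans (δ≡1 d refl) (sym (∈⇒≡true (alternating⁺ {S} id bd δ≡1)))

  white⇒rev-black : ∀ d → colour (origin d) ≢ black → colour (origin (rev d)) ≡ black
  white⇒rev-black d ¬bd with colour (origin d) | colour (origin (rev d)) | proper d
  ... | black | _     | _    = contradiction refl ¬bd
  ... | white | black | _    = refl
  ... | white | white | w≢w  = contradiction refl w≢w

  nest⇒compatible : ∀ {S} → IsBilliardNest G S → Compatible S (alternating S)
  nest⇒compatible {S} N d ¬ed with black? (colour (origin d))
  ... | yes bd = trans (nest⇒δ N d ¬ed bd)
                       (sym (coboundary-black {alternating S} (alternating-blackInternal S) d bd))
  -- The edge is read from its other end, which is black.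
  ... | no ¬bd = begin
    δ (lookup S) d                            ≡⟨ δ-rev (lookup S) d ⟨
    δ (lookup S) (rev d)
      ≡⟨ nest⇒δ N (rev d) (¬ed ∘ subst Ext (rev-involutive d) ∘ ext-rev (rev d)) bd′ ⟩
    lookup (alternating S) (origin (rev d))
      ≡⟨ coboundary-black {alternating S} (alternating-blackInternal S) (rev d) bd′ ⟨
    coboundary (alternating S) (rev d)        ≡⟨ coboundary-rev (alternating S) d ⟩
    coboundary (alternating S) d              ∎
    where bd′ = white⇒rev-black d ¬bd

  -- Around an internal black vertex `S` jumps at every dart or at none, according to `C`. An
  -- external one lies outside `C`, so its inner sectors are joined without a jump.
  compatible⇒nest : ∀ {S C} → outerFace ∉ S → BlackInternal C → Compatible S C → IsBilliardNest G S
  compatible⇒nest {S} {C} o∉S bi compat = nest o∉S internalBlack externalBlack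
    where
    crossing : ∀ {b} → colour b ≡ black → ∀ d → origin d ≡ b → ¬ Ext d → δ (lookup S) d ≡ lookup C b
    crossing bb d refl ¬ed = trans (compat d ¬ed) (coboundary-black {C} bi d bb)

    internalBlack : ∀ b → Internal b → colour b ≡ black → AllSectors G b S ⊎ NoSectors G b S ⊎ AlternateSectors G b S
    internalBlack b ib bb with d₀ , refl ← dartAt ib bb | lookup C b in Cb | lookup S (face d₀) in Sd₀
    ... | true  | _     = inj₂ (inj₂ (⇒alternateSectors (d₀ , refl)
                            (λ d od → trans (crossing bb d od (λ ed → ib (subst External od (proj₁ ed)))) Cb)))
    ... | false | β     = decide β Sd₀
      where
      step : ∀ j → lookup S (face (fold d₀ next j)) ≡ lookup S (face d₀)
      step zero    = refl
      step (suc j) = trans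
        (xor≡false⇒≡ (trans (crossing bb _ (origin-fold d₀ (suc j))
            (λ ed → ib (subst External (origin-fold d₀ (suc j)) (proj₁ ed)))) Cb))
        (trans (cong (lookup S) (face-sector _)) (step j))
      constant : ∀ d → origin d ≡ origin d₀ → lookup S (face d) ≡ lookup S (face d₀)
      constant d od with j , refl ← next-cyclic d₀ d (sym od) = step j
      decide : ∀ β → lookup S (face d₀) ≡ β →
               AllSectors G (origin d₀) S ⊎ NoSectors G (origin d₀) S ⊎ AlternateSectors G (origin d₀) S
      decide true  e = inj₁ (λ d od → ≡true⇒∈ (trans (constant d od) e))
      decide false e = inj₂ (inj₁ (λ d od → ≡false⇒∉ (trans (constant d od) e)))

    externalBlack : ∀ b → External b → colour b ≡ black → AllInternalFaces G b S ⊎ NoInternalFaces G b S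
    externalBlack b xb bb = decide _ refl
      where
      open OuterSector (outerSector xb)
      δ≡0 : ∀ d → origin d ≡ b → ¬ Ext d → δ (lookup S) d ≡ false
      δ≡0 d od ¬ed = trans (crossing bb d od ¬ed) (∉⇒≡false λ b∈C → proj₁ (bi b b∈C) xb)
      value : ∀ f → f ≢ outerFace → Incident b f → lookup S f ≡ lookup S (face (next dart))
      value f f≢ (inj₁ (d , od , refl)) = inner-sectors-constant (lookup S) (outerSector xb) δ≡0 d od f≢
      value f f≢ (inj₂ (isolated , _))  = contradiction at (isolated dart)
      decide : ∀ β → lookup S (face (next dart)) ≡ β → AllInternalFaces G b S ⊎ NoInternalFaces G b S
      decide true  e = inj₁ (λ f f≢ inc → ≡true⇒∈ (trans (value f f≢ inc) e))
      decide false e = inj₂ (λ f f≢ inc → ≡false⇒∉ (trans (value f f≢ inc) e))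

  compatible-unique : ∀ {S T} C → outerFace ∉ S → outerFace ∉ T → Compatible S C → Compatible T C →
                      lookup S innerFace ≡ lookup T innerFace → S ≡ T
  compatible-unique {S} {T} C o∉S o∉T cS cT eq = lookup-ext λ f →
    xor≡false⇒≡ (outer-δ≡0⇒≡0 (λ f → lookup S f xor lookup T f)
    (λ d ¬ed → trans (δ-xor (lookup S) (lookup T) d)
      (trans (cong₂ _xor_ (cS d ¬ed) (cT d ¬ed)) (xor-same (coboundary C d))))
    (cong₂ _xor_ (∉⇒≡false o∉S) (∉⇒≡false o∉T))
    (trans (cong (_xor lookup T innerFace) eq) (xor-same (lookup T innerFace))) f)

  private
    isChannel? = isBlackChannel? innerSubgraph colour

  -- Both inequalities come from `code`: it is injective on nests by `compatible-unique`, and it is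
  -- a left inverse of `nestOf`.
  ∣𝓑∣≡2∣𝓒ᴮ∣ : length (𝓑 G) ≡ 2 * length (𝓒ᴮ innerSubgraph colour)
  ∣𝓑∣≡2∣𝓒ᴮ∣ = trans (ℕ.≤-antisym
    (injection⇒∣filter∣≤ (isBilliardNest? G) (isChannel? ∘ tail)
      (λ {S} _ → code S)
      (λ {S} N → compatible⇒channel {S} (alternating-blackInternal S) (nest⇒compatible N))
      (λ {S} {T} N M eq → let bit , alt = ∷-injective eq in
        compatible-unique (alternating S) (IsBilliardNest.internalFaces N) (IsBilliardNest.internalFaces M)
          (nest⇒compatible N) (subst (Compatible T) (sym alt) (nest⇒compatible M)) bit))
    (injection⇒∣filter∣≤ (isChannel? ∘ tail) (isBilliardNest? G)
      (λ {βC} → nestOf βC) (λ {βC} → nestOf-nest βC)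
      (λ {βC} {γD} p q eq → trans (sym (code-nestOf βC p)) (trans (cong code eq) (code-nestOf γD q)))))
    (length-filter-tail isChannel?)
    where
    code : Subset nF → Subset (suc nV)
    code S = lookup S innerFace ∷ alternating S
    nestOf : ∀ βC → IsBlackChannel innerSubgraph colour (tail βC) → Subset nF
    nestOf (β ∷ C) ch = proj₁ (realise ch β)
    nestOf-nest : ∀ βC (ch : IsBlackChannel innerSubgraph colour (tail βC)) → IsBilliardNest G (nestOf βC ch)
    nestOf-nest (β ∷ C) ch = let S , o∉S , compat , _ = realise ch β in
      compatible⇒nest {S} {C} o∉S (channel⇒blackInternal ch) compat
    code-nestOf : ∀ βC (ch : IsBlackChannel innerSubgraph colour (tail βC)) → code (nestOf βC ch) ≡ βC
    code-nestOf (β ∷ C) ch = let S , _ , compat , bit = realise ch β in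
      cong₂ _∷_ bit (alternating-unique {S} {C} (channel⇒blackInternal ch) compat)

theorem4p5 : (G : BipartitePlaneGraph) →
    InnerSemiEulerian G →
    NoIsolatedInternalBlack G →
    IsSimpleCycle (BipartitePlaneGraph.outerSubgraph G) →
    length (𝓑 G) ≡ 2 * length (𝓒ᴮ (BipartitePlaneGraph.innerSubgraph G) (BipartitePlaneGraph.colour G))
theorem4p5 = Nests.∣𝓑∣≡2∣𝓒ᴮ∣
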